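{- For every integer $n\ge1$ there is a bijection $\phi:\mathfrak S_n^{\bullet}(1^n)\to\mathfrak S_n$, where $\mathfrak S_n^{\bullet}(1^n)$ is the set of decorated permutations of $\{1,\dots,n\}$ all of whose schedule numbers equal $1$, such that for all $\tau\in\mathfrak S_n^{\bullet}(1^n)$: (i) $\mathsf{revmaj}(\tau)=\mathsf{inv}_3(\phi(\tau))$; (ii) $\mathsf{dec}(\tau)=\mathsf{monot}(\phi(\tau))$.
   Context: A decorated permutation of $[n]=\{1,\dots,n\}$ is a permutation $\tau=\tau_1\cdots\tau_n$ of $[n]$ together with a (possibly empty) subset of its letters that are called decorated; $\mathfrak S_n^\bullet$ is the set of decorated permutations and $\mathsf{dec}(\tau)$ is the number of decorated letters. By convention every (decorated) permutation is preceded by $\tau_0=0$, which is never decorated. Schedule numbers. Let $r_0,r_1,r_2,\dots$ be the maximal decreasing runs of consecutive letters of the word $\tau_0\tau_1\cdots\tau_n$ (so $r_0$ consists of $0$ only). For $1\le i\le n$ with $\tau_i$ in $r_j$: if $\tau_i$ is undecorated, $s_i=\#\{k\in r_j: k\text{ undecorated},\,k>\tau_i\}+\#\{k\in r_{j-1}: k\text{ undecorated},\,k<\tau_i\}$; if $\tau_i$ is decorated, $s_i=\#\{k\in r_j: k\text{ undecorated},\,k<\tau_i\}+\#\{k\in r_{j+1}: k\text{ undecorated},\,k>\tau_i\}$ (with $r_{j+1}$ empty if $r_j$ is the last run). $\mathfrak S_n^\bullet(1^n)$ is the set of $\tau\in\mathfrak S_n^\bullet$ with $s_i=1$ for all $1\le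 i\le n$. $\mathsf{revmaj}(\tau)$ is the major index (sum of the descent positions $i\in[n-1]$, those with $\rho_i>\rho_{i+1}$) of the reversed underlying permutation $\rho=\tau_n\tau_{n-1}\cdots\tau_1$. Statistics on permutations. For $\sigma\in\mathfrak S_n$ put $\sigma_0=0$. For $i\in\{2,\dots,n\}$, $\sigma_i$ is a double ascent if $\sigma_{i-2}<\sigma_{i-1}<\sigma_i$; a double descent if $\sigma_{i-2}>\sigma_{i-1}>\sigma_i$; a peak if $\sigma_{i-2}<\sigma_{i-1}>\sigma_i$; a valley if $\sigma_{i-2}>\sigma_{i-1}<\sigma_i$. $\mathsf{monot}(\sigma)$ is the number of $i\in\{2,\dots,n\}$ such that $\sigma_i$ is a double ascent or a double descent. A pair $(i,j)$ with $1\le i<j\le n$ is a $3$-inversion of $\sigma$ if one of the following holds: $\sigma_j$ is a double ascent and $\sigma_{j-1}<\sigma_i<\sigma_j$; $\sigma_j$ is a double descent and $\sigma_{j-1}>\sigma_i>\sigma_j$; $\sigma_j$ is a peak and $\sigma_i>\sigma_j$; $\sigma_j$ is a valley and $\sigma_i<\sigma_j$. $\mathsf{inv}_3(\sigma)$ is the number of $3$-inversions of $\sigma$. -}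

module Defs where

open import Data.Bool.Base using (if_then_else_)
open import Data.Fin.Base using (Fin; zero; suc; toℕ; pred; inject₁; _<_; _>_)
open import Data.Fin.Permutation using (Permutation′; _⟨$⟩ʳ_; _≈_; _∘ₚ_; lift₀; reverse)
open import Data.Fin.Properties using (_≟_; _<?_)
open import Data.Fin.Subset using (Subset; _∉_; ∣_∣; outside)
import Data.Fin.Subset.Properties as Subset
open import Data.List.Base using (List; []; _∷_; length; filter; map; foldr; allFin; cartesianProduct)
import Data.List.Membership.DecPropositional as DecMembership
open import Data.Nat.Base as ℕ using (ℕ; zero; suc; _+_; _≤_)
open import Data.Nat.ListAction using (sum)
import Data.Nat.Properties as ℕ
open import Data.Product.Base using (Σ-syntax; _×_; _,_; proj₁; uncurry)
open import Data.Product.Relation.Binary.Pointwise.NonDependent using (×-setoid)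
open import Data.Sum.Base using (_⊎_)
import Data.Vec.Base as Vec
open import Level using (0ℓ)
open import Relation.Binary.Bundles using (Setoid)
import Relation.Binary.Construct.On as On
open import Relation.Binary.PropositionalEquality.Core using (_≡_; refl; sym; trans)
open import Relation.Binary.PropositionalEquality.Properties using (setoid)
open import Relation.Nullary.Decidable using (Dec; does; ¬?; _×-dec_; _⊎-dec_)
open import Relation.Unary using (Pred; Decidable)

private
  variable
    n : ℕ
    A : Set

count : {P : Pred A 0ℓ} → Decidable P → List A → ℕ
count P? xs = length (filter P? xs)

-- A permutation of [n] is a bijection of Fin n, the element i of Fin n standing
-- for i + 1.  Prefixing the word with the letter 0 in position 0 is then
-- exactly lift₀, and in Fin (suc n) positions and letters carry their usual
-- names 0, 1, …, n.

letter : Permutation′ n → Fin (suc n) → Fin (suc n)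
letter σ i = lift₀ σ ⟨$⟩ʳ i

word : Permutation′ n → List (Fin (suc n))
word {n} σ = map (letter σ) (allFin (suc n))

-- Permutations are compared as functions, ignoring the proofs they carry.

permutationSetoid : ℕ → Setoid 0ℓ 0ℓ
permutationSetoid n = record
  { Carrier       = Permutation′ n
  ; _≈_           = _≈_
  ; isEquivalence = record
    { refl  = λ _ → refl
    ; sym   = λ p i → sym (p i)
    ; trans = λ p q i → trans (p i) (q i)
    }
  }

-- The subset records decorated letters (values, not positions).

DecoratedPermutation : ℕ → Set
DecoratedPermutation n = Permutation′ n × Subset n

decoratedPermutationSetoid : ℕ → Setoid 0ℓ 0ℓ
decoratedPermutationSetoid n = ×-setoid (permutationSetoid n) (setoid (Subset n))

dec : DecoratedPermutation n → ℕ
dec (_ , D) = ∣ D ∣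

-- The letter 0 is never decorated.

Undecorated : Subset n → Pred (Fin (suc n)) 0ℓ
Undecorated D k = k ∉ (outside Vec.∷ D)

undecorated? : (D : Subset n) → Decidable (Undecorated D)
undecorated? D k = ¬? (k Subset.∈? (outside Vec.∷ D))

-- The maximal decreasing runs of a word, from left to right.

addToRuns : Fin n → List (List (Fin n)) → List (List (Fin n))
addToRuns a ((b ∷ r) ∷ rs) =
  if does (b <? a) then (a ∷ b ∷ r) ∷ rs else (a ∷ []) ∷ (b ∷ r) ∷ rs
addToRuns a rs = (a ∷ []) ∷ rs

runs : List (Fin n) → List (List (Fin n))
runs = foldr addToRuns []

nthRun : List (List A) → ℕ → List A
nthRun []       _       = []
nthRun (r ∷ rs) zero    = r
nthRun (r ∷ rs) (suc j) = nthRun rs j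

runIndex : Fin n → List (List (Fin n)) → ℕ
runIndex a []       = 0
runIndex a (r ∷ rs) = if does (a ∈? r) then 0 else suc (runIndex a rs)
  where open DecMembership _≟_ using (_∈?_)

-- The schedule number of the letter in position i + 1.  Its run index j is
-- always positive, since run 0 consists of the letter 0 alone.

schedule : DecoratedPermutation n → Fin n → ℕ
schedule (τ , D) i =
  if does (undecorated? D a)
  then count (λ k → undecorated? D k ×-dec (a <? k)) (r j)
     + count (λ k → undecorated? D k ×-dec (k <? a)) (r (ℕ.pred j))
  else count (λ k → undecorated? D k ×-dec (k <? a)) (r j)
     + count (λ k → undecorated? D k ×-dec (a <? k)) (r (suc j))
  where
  a = letter τ (suc i)
  r = nthRun (runs (word τ))
  j = runIndex a (runs (word τ))

UnitSchedule : Pred (DecoratedPermutation n) 0ℓ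
UnitSchedule τ = ∀ i → schedule τ i ≡ 1

unitScheduleSetoid : ℕ → Setoid 0ℓ 0ℓ
unitScheduleSetoid n =
  On.setoid {B = Σ[ τ ∈ DecoratedPermutation n ] UnitSchedule τ}
            (decoratedPermutationSetoid n) proj₁

-- Here i ranges over 0, …, n - 1.  The position i = 0 is not a descent, as
-- letter ρ zero is 0, and it would contribute 0 anyway.

maj : Permutation′ n → ℕ
maj {n} ρ = sum (map toℕ (filter descent? (allFin n)))
  where
  descent? : Decidable (λ i → letter ρ (inject₁ i) > letter ρ (suc i))
  descent? i = letter ρ (suc i) <? letter ρ (inject₁ i)

-- _∘ₚ_ is diagrammatic: reverse acts first, on positions.

revmaj : DecoratedPermutation n → ℕ
revmaj (τ , _) = maj (reverse ∘ₚ τ)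

module _ (σ : Permutation′ n) where

  private
    σ[_] : Fin (suc n) → Fin (suc n)
    σ[_] = letter σ

  DoubleAscent DoubleDescent Peak Valley : Pred (Fin (suc n)) 0ℓ
  DoubleAscent  i = 2 ≤ toℕ i × σ[ pred (pred i) ] < σ[ pred i ] × σ[ pred i ] < σ[ i ]
  DoubleDescent i = 2 ≤ toℕ i × σ[ pred (pred i) ] > σ[ pred i ] × σ[ pred i ] > σ[ i ]
  Peak          i = 2 ≤ toℕ i × σ[ pred (pred i) ] < σ[ pred i ] × σ[ pred i ] > σ[ i ]
  Valley        i = 2 ≤ toℕ i × σ[ pred (pred i) ] > σ[ pred i ] × σ[ pred i ] < σ[ i ]

  doubleAscent? : Decidable DoubleAscent
  doubleAscent? i = (2 ℕ.≤? toℕ i) ×-dec (_ <? _) ×-dec (_ <? _)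

  doubleDescent? : Decidable DoubleDescent
  doubleDescent? i = (2 ℕ.≤? toℕ i) ×-dec (_ <? _) ×-dec (_ <? _)

  peak? : Decidable Peak
  peak? i = (2 ℕ.≤? toℕ i) ×-dec (_ <? _) ×-dec (_ <? _)

  valley? : Decidable Valley
  valley? i = (2 ℕ.≤? toℕ i) ×-dec (_ <? _) ×-dec (_ <? _)

  monot : ℕ
  monot = count (λ i → doubleAscent? i ⊎-dec doubleDescent? i) (allFin (suc n))

  ThreeInversion : Fin (suc n) → Fin (suc n) → Set
  ThreeInversion i j =
      1 ≤ toℕ i × i < j
    × ( (DoubleAscent j × σ[ pred j ] < σ[ i ] × σ[ i ] < σ[ j ])
      ⊎ (DoubleDescent j × σ[ pred j ] > σ[ i ] × σ[ i ] > σ[ j ])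
      ⊎ (Peak j × σ[ i ] > σ[ j ])
      ⊎ (Valley j × σ[ i ] < σ[ j ]))

  threeInversion? : ∀ i j → Dec (ThreeInversion i j)
  threeInversion? i j =
    (1 ℕ.≤? toℕ i) ×-dec (i <? j) ×-dec
      (        (doubleAscent? j ×-dec (_ <? _) ×-dec (_ <? _))
      ⊎-dec ((doubleDescent? j ×-dec (_ <? _) ×-dec (_ <? _))
      ⊎-dec ((peak? j ×-dec (_ <? _))
      ⊎-dec  (valley? j ×-dec (_ <? _)))))

  inv₃ : ℕ
  inv₃ = count (uncurry threeInversion?) (cartesianProduct (allFin (suc n)) (allFin (suc n)))

{-# OPTIONS --safe #-}

-- Give the values 0, …, n a cyclic order.  Reading τ from its first letter, the
-- number of later letters on the arc from each letter up to its predecessor is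
-- a code with entries e₁ ≤ n - 1, e₂ ≤ n - 2, …, and the sum of the code is
-- revmaj(τ): a letter of the run r_j is passed j - 1 times.  A permutation has a
-- unique decoration with unit schedule numbers, because these mean that,
-- walking down once round the circle from any letter but the last, one meets
-- exactly one undecorated letter.  Hence a letter is decorated if and only if
-- its predecessor is no further up than the next undecorated letter, which the
-- code decides.  Removing instead the last letter of σ, the number of
-- 3-inversions at the last position is a code of the same kind: an entry within
-- the reach of the preceding letters continues the current direction, and a
-- larger one turns it.  Both codes are bijections that follow the same rule for
-- the reach, so that decorated letters correspond to double ascents and double
-- descents.

module Submission where

open import Defs
open import Data.Bool.Base using (Bool; true; false; not; if_then_else_; _∧_; _∨_)
import Data.Bool.Properties as Bool
open import Data.Bool.Properties using (∧-comm; ∧-identityʳ; ∨-identityʳ; not-injective; T-≡)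
open import Data.Fin.Base as Fin using (Fin; zero; suc; toℕ; fromℕ; fromℕ<; inject₁; opposite; punchIn; pred)
open import Data.Fin.Permutation as Perm using (Permutation′; _⟨$⟩ʳ_; _⟨$⟩ˡ_; _≈_; _∘ₚ_; inverseˡ; inverseʳ; lift₀; lift₀-cong; reverse; insert; remove; punchIn-permute; remove-insert)
import Data.Fin.Properties as Fin
open import Data.Fin.Relation.Unary.Top using (view; ‵fromℕ; ‵inject₁)
open import Data.Fin.Subset using (Subset; ∣_∣; inside; outside)
import Data.Fin.Subset.Properties as Subset
open import Data.List.Base as List using (List; []; _∷_; _++_; length; filter; tabulate; cartesianProduct)
import Data.List.Properties as List
open import Data.Nat.Base as ℕ using (ℕ; zero; suc; _+_; _*_; _∸_; _≤_; _<_; _≤ᵇ_; _<ᵇ_; _≡ᵇ_; s≤s; z≤n)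
open import Data.Nat.ListAction using (sum)
import Data.Nat.Properties as ℕ
open import Algebra.Properties.CommutativeMonoid.Sum ℕ.+-0-commutativeMonoid using (sum-cong-≗; ∑-distrib-+; sum-permute; sum-init-last; sum-replicate-zero) renaming (sum to ∑)
open import Data.Nat.Tactic.RingSolver using (solve-∀)
open import Data.Product using (∃!)
open import Data.Product.Base using (Σ-syntax; ∃; ∃₂; _×_; _,_; proj₁; proj₂; uncurry)
open import Data.Sum.Base using (_⊎_; inj₁; inj₂)
import Data.Vec.Base as Vec
import Data.Vec.Properties as Vec
open import Function.Base using (_∘_; id; case_of_)
open import Function.Bundles using (Bijection; module Equivalence; module Injection)
open import Function.Properties.Inverse using (↔⇒↣)
open import Level using (0ℓ)
open import Relation.Binary.PropositionalEquality using (_≡_; _≢_; refl; sym; trans; cong; cong₂; subst; module ≡-Reasoning)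
open import Relation.Nullary using (¬_; does; yes; no; contradiction)
open import Relation.Nullary.Decidable using (dec-true; dec-false; _×-dec_; _⊎-dec_)
open import Relation.Unary using (Pred; Decidable)

-- Removing a letter renumbers the remaining values, so a removed letter survives only as a gap
-- between them. Statements about circles are therefore proved for an arbitrary gap `a`; the theorem
-- uses the gap `zero`, the place of the letter 0.
--
-- The obstacle is that schedule numbers look backwards from undecorated letters and forwards from
-- decorated ones, so unit schedule numbers are not inherited by the word without its first letter.
-- `Rule` looks forwards only and restricts to the tail of the word. It is equivalent to unit
-- schedule numbers because windows are intervals of positions. Uniqueness of the decoration is then
-- an induction from the right. For existence the induction has to carry more than the rule: it also
-- identifies `reach` with the number of letters from the gap up to the undecorated letter in its
-- window, which is what the next entry of the code is compared with.

private
  variable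
    m n N : ℕ
    A B   : Set

-- Codes of permutations

-- The decision procedures of the definitions compute to `<ᵇ`. Indexing the view by that Boolean
-- lets a single match both evaluate the Boolean and supply the inequality.
data Compare (k l : ℕ) : Bool → Set where
  less    : k < l → Compare k l true
  notLess : l ≤ k → Compare k l false

compare : ∀ k l → Compare k l (k ℕ.<ᵇ l)
compare k l with k ℕ.<? l
... | yes k<l = subst (Compare k l) (sym (dec-true (k ℕ.<? l) k<l)) (less k<l)
... | no  k≮l = subst (Compare k l) (sym (dec-false (k ℕ.<? l) k≮l)) (notLess (ℕ.≮⇒≥ k≮l))

-- The head belongs to the letter removed first, which is the first letter of τ but the last letter
-- of σ: the same list runs through the two words in opposite directions.
data Code : ℕ → Set where
  []  : Code 0
  _∷_ : Fin (suc n) → Code n → Code (suc n)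

infixr 5 _∷_

∷-injective : {e e′ : Fin (suc n)} {c c′ : Code n} →
              e ∷ c ≡ e′ ∷ c′ → e ≡ e′ × c ≡ c′
∷-injective refl = refl , refl

weight : Code n → ℕ
weight []      = 0
weight (e ∷ c) = toℕ e + weight c

-- In a circle, the number of letters from the gap up to and including the next
-- undecorated one.  In a zigzag, one more than the number of letters beyond the
-- last one in the direction of its last step.

reach : Code n → ℕ
reach []              = 0
reach (_∷_ {n = n} e c) =
  if toℕ e ℕ.<ᵇ reach c then reach c ∸ toℕ e else suc n ∸ toℕ e

-- The value at `[]` is a seed. As `reach []` is 0, the earliest entry always turns the direction,
-- to ascending. This is the step from the letter 0 to the first letter, and it is undecorated just
-- as position 1 is neither a double ascent nor a double descent.
ascending : Code n → Bool
ascending []      = false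
ascending (e ∷ c) =
  if toℕ e ℕ.<ᵇ reach c then ascending c else not (ascending c)

decorations : Code n → Fin n → Bool
decorations (e ∷ c) zero    = toℕ e ℕ.<ᵇ reach c
decorations (e ∷ c) (suc i) = decorations c i

data ReachStep (n e r : ℕ) (b : Bool) : ℕ → Bool → Bool → Set where
  short : ∀ {s} → e < r → s + e ≡ r → ReachStep n e r b s true b
  long  : ∀ {s} → r ≤ e → s + e ≡ suc n → ReachStep n e r b s false (not b)

reachStep : (e : Fin (suc n)) (c : Code n) →
            ReachStep n (toℕ e) (reach c) (ascending c)
              (reach (e ∷ c)) (decorations (e ∷ c) zero) (ascending (e ∷ c))
reachStep e c with toℕ e ℕ.<ᵇ reach c | compare (toℕ e) (reach c)
... | _ | less    e<s = short e<s (ℕ.m∸n+n≡m (ℕ.<⇒≤ e<s))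
... | _ | notLess s≤e = long s≤e (ℕ.m∸n+n≡m (ℕ.<⇒≤ (Fin.toℕ<n e)))

reach≤ : (c : Code n) → reach c ≤ n
reach≤ []      = z≤n
reach≤ (_∷_ {n} e c) = bound (reachStep e c)
  where
  bound : ∀ {s d b} → ReachStep n (toℕ e) (reach c) (ascending c) s d b → s ≤ suc n
  bound {s} (short _ q) = ℕ.≤-trans (ℕ.m+n≤o⇒m≤o s (ℕ.≤-reflexive q)) (ℕ.m≤n⇒m≤1+n (reach≤ c))
  bound {s} (long  _ q) = ℕ.m+n≤o⇒m≤o s (ℕ.≤-reflexive q)

finOf : ∀ {k} → k < n → Σ[ i ∈ Fin n ] toℕ i ≡ k
finOf k<n = fromℕ< k<n , Fin.toℕ-fromℕ< k<n

-- Remove the letter x from a circle in which the gap a is marked: e counts the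
-- letters met when going upwards from x to a.

data Arc (m a x e : ℕ) : Set where
  direct  : x < a → e + suc x ≡ a → Arc m a x e
  wrapped : a ≤ x → e + x ≡ m + a → Arc m a x e

abstract

  arc : (a : Fin (suc (suc m))) (x : Fin (suc m)) →
        Σ[ e ∈ Fin (suc m) ] Arc m (toℕ a) (toℕ x) (toℕ e)
  arc {m} a x with toℕ x ℕ.<? toℕ a
  ... | yes x<a =
    let e , q = finOf {n = suc m} {k = toℕ a ∸ suc (toℕ x)}
                  (s≤s (ℕ.≤-trans (ℕ.∸-monoʳ-≤ (toℕ a) (s≤s z≤n)) (ℕ.∸-monoˡ-≤ 1 (Fin.toℕ≤pred[n] a))))
    in e , direct x<a (trans (cong (_+ suc (toℕ x)) q) (ℕ.m∸n+n≡m x<a))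
  ... | no x≮a =
    let a≤x = ℕ.≮⇒≥ x≮a
        e , q = finOf {n = suc m} {k = (m + toℕ a) ∸ toℕ x}
                  (s≤s (ℕ.≤-trans (ℕ.∸-monoˡ-≤ (toℕ x) (ℕ.+-monoʳ-≤ m a≤x)) (ℕ.≤-reflexive (ℕ.m+n∸n≡m m (toℕ x)))))
    in e , wrapped a≤x (trans (cong (_+ toℕ x) q)
             (ℕ.m∸n+n≡m (ℕ.≤-trans (Fin.toℕ≤pred[n] x) (ℕ.m≤m+n m (toℕ a)))))

arcLength : Fin (suc (suc m)) → Fin (suc m) → Fin (suc m)
arcLength a x = proj₁ (arc a x)

-- The equations in `Arc` are symmetric in `x` and `e`, and they force `e < a` exactly when `x < a`.
-- So one map encodes the letter and decodes the entry.
arcLength-involutive : (a : Fin (suc (suc m))) (x : Fin (suc m)) → arcLength a (arcLength a x) ≡ x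
arcLength-involutive {m} a x = Fin.toℕ-injective (involutive (proj₂ (arc a x)) (proj₂ (arc a (arcLength a x))))
  where
  involutive : ∀ {e y} → Arc m (toℕ a) (toℕ x) e → Arc m (toℕ a) e y → y ≡ toℕ x
  involutive {e} {y} (direct _ p) (direct _ q) =
    ℕ.+-cancelʳ-≡ (suc e) y (toℕ x)
      (trans q (trans (sym p) (trans (ℕ.+-suc e (toℕ x)) (trans (cong suc (ℕ.+-comm e (toℕ x))) (sym (ℕ.+-suc (toℕ x) e))))))
  involutive {e} (direct _ p) (wrapped a≤e _) =
    contradiction (ℕ.≤-trans (ℕ.m≤m+n (suc e) (toℕ x)) (ℕ.≤-reflexive (trans (sym (ℕ.+-suc e (toℕ x))) p))) (ℕ.≤⇒≯ a≤e)
  involutive {e} (wrapped _ p) (direct e<a _) =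
    contradiction p (ℕ.<⇒≢ (ℕ.≤-trans (ℕ.+-mono-<-≤ e<a (Fin.toℕ≤pred[n] x)) (ℕ.≤-reflexive (ℕ.+-comm (toℕ a) m))))
  involutive {e} {y} (wrapped _ p) (wrapped _ q) =
    ℕ.+-cancelʳ-≡ e y (toℕ x) (trans q (trans (sym p) (ℕ.+-comm e (toℕ x))))

-- Here `u` is the number of earlier letters beyond the new last letter in the current direction,
-- and `s` is the reach. If `u < s`, the word continues in this direction and `e` counts the letters
-- jumped over; otherwise it turns, and all `u` letters beyond the new one are 3-inversions.
data Flip (s u e : ℕ) : Set where
  below : u < s → e + suc u ≡ s → Flip s u e
  above : s ≤ u → e ≡ u → Flip s u e

abstract

  flip : ∀ {s} → s ≤ n → (u : Fin n) → Σ[ e ∈ Fin n ] Flip s (toℕ u) (toℕ e)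
  flip {n} {s} s≤n u with toℕ u ℕ.<? s
  ... | yes u<s =
    let e , q = finOf {k = s ∸ suc (toℕ u)}
                  (ℕ.≤-<-trans (ℕ.∸-monoˡ-≤ (suc (toℕ u)) s≤n) (ℕ.∸-monoʳ-< {n} (s≤s z≤n) (Fin.toℕ<n u)))
    in e , below u<s (trans (cong (_+ suc (toℕ u)) q) (ℕ.m∸n+n≡m u<s))
  ... | no u≮s = u , above (ℕ.≮⇒≥ u≮s) refl

flip-involutive : ∀ {s} (s≤n : s ≤ n) (u : Fin n) → proj₁ (flip s≤n (proj₁ (flip s≤n u))) ≡ u
flip-involutive {s = s} s≤n u =
  Fin.toℕ-injective (involutive (proj₂ (flip s≤n u)) (proj₂ (flip s≤n (proj₁ (flip s≤n u)))))
  where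
  involutive : ∀ {e y} → Flip s (toℕ u) e → Flip s e y → y ≡ toℕ u
  involutive {e} {y} (below _ p) (below _ q) =
    ℕ.+-cancelʳ-≡ (suc e) y (toℕ u)
      (trans q (trans (sym p) (trans (ℕ.+-suc e (toℕ u)) (trans (cong suc (ℕ.+-comm e (toℕ u))) (sym (ℕ.+-suc (toℕ u) e))))))
  involutive {e} (below _ p) (above s≤e _) =
    contradiction (ℕ.≤-trans (ℕ.m≤m+n (suc e) (toℕ u)) (ℕ.≤-reflexive (trans (sym (ℕ.+-suc e (toℕ u))) p))) (ℕ.≤⇒≯ s≤e)
  involutive (above s≤u refl) (below u<s _) = contradiction u<s (ℕ.≤⇒≯ s≤u)
  involutive (above _ p) (above _ q) = trans q p

-- Abstract, lest conversion checking unfold the proofs inside remove.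

abstract

  delete : Fin (suc n) → Permutation′ (suc n) → Permutation′ n
  delete = remove

  permute-punchIn : (i : Fin (suc n)) (π : Permutation′ (suc n)) (j : Fin n) →
                    π ⟨$⟩ʳ punchIn i j ≡ punchIn (π ⟨$⟩ʳ i) (delete i π ⟨$⟩ʳ j)
  permute-punchIn i π = punchIn-permute π i

  delete-insert : (i j : Fin (suc n)) (π : Permutation′ n) → delete i (insert i j π) ≈ π
  delete-insert = remove-insert

-- The place of the removed letter becomes the next gap. Among the renumbered values this gap has
-- the number which the letter had.
cyclicCode : Fin (suc n) → Permutation′ n → Code n
cyclicCode {zero}  a τ = []
cyclicCode {suc n} a τ = arcLength a (τ ⟨$⟩ʳ zero) ∷ cyclicCode (τ ⟨$⟩ʳ zero) (delete zero τ)

delete-cong : (i : Fin (suc n)) (π ρ : Permutation′ (suc n)) → π ≈ ρ → delete i π ≈ delete i ρ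
delete-cong i π ρ π≈ρ j = Fin.punchIn-injective (π ⟨$⟩ʳ i) _ _ (begin
  punchIn (π ⟨$⟩ʳ i) (delete i π ⟨$⟩ʳ j)  ≡⟨ permute-punchIn i π j ⟨
  π ⟨$⟩ʳ punchIn i j                      ≡⟨ π≈ρ (punchIn i j) ⟩
  ρ ⟨$⟩ʳ punchIn i j                      ≡⟨ permute-punchIn i ρ j ⟩
  punchIn (ρ ⟨$⟩ʳ i) (delete i ρ ⟨$⟩ʳ j)  ≡⟨ cong (λ x → punchIn x _) (π≈ρ i) ⟨
  punchIn (π ⟨$⟩ʳ i) (delete i ρ ⟨$⟩ʳ j)  ∎)
  where open ≡-Reasoning

delete-injective : (i : Fin (suc n)) (π ρ : Permutation′ (suc n)) →
                   π ⟨$⟩ʳ i ≡ ρ ⟨$⟩ʳ i → delete i π ≈ delete i ρ → π ≈ ρ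
delete-injective i π ρ p q j with i Fin.≟ j
... | yes refl = p
... | no  i≢j  = begin
  π ⟨$⟩ʳ j                                        ≡⟨ cong (π ⟨$⟩ʳ_) (Fin.punchIn-punchOut i≢j) ⟨
  π ⟨$⟩ʳ punchIn i _                              ≡⟨ permute-punchIn i π _ ⟩
  punchIn (π ⟨$⟩ʳ i) (delete i π ⟨$⟩ʳ _)          ≡⟨ cong₂ punchIn p (q _) ⟩
  punchIn (ρ ⟨$⟩ʳ i) (delete i ρ ⟨$⟩ʳ _)          ≡⟨ permute-punchIn i ρ _ ⟨
  ρ ⟨$⟩ʳ punchIn i _                              ≡⟨ cong (ρ ⟨$⟩ʳ_) (Fin.punchIn-punchOut i≢j) ⟩
  ρ ⟨$⟩ʳ j                                        ∎
  where open ≡-Reasoning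

cyclicCode-cong : (a : Fin (suc n)) (τ ρ : Permutation′ n) → τ ≈ ρ → cyclicCode a τ ≡ cyclicCode a ρ
cyclicCode-cong {zero}  a τ ρ τ≈ρ = refl
cyclicCode-cong {suc n} a τ ρ τ≈ρ = cong₂ _∷_ (cong (arcLength a) (τ≈ρ zero)) (trans
  (cyclicCode-cong _ (delete zero τ) (delete zero ρ) (delete-cong zero τ ρ τ≈ρ))
  (cong (λ x → cyclicCode x (delete zero ρ)) (τ≈ρ zero)))

cyclicCode-injective : (a : Fin (suc n)) (τ ρ : Permutation′ n) → cyclicCode a τ ≡ cyclicCode a ρ → τ ≈ ρ
cyclicCode-injective {suc n} a τ ρ p with ∷-injective p
... | q , r = delete-injective zero τ ρ x≡y
                (cyclicCode-injective (τ ⟨$⟩ʳ zero) (delete zero τ) (delete zero ρ)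
                  (trans r (cong (λ x → cyclicCode x (delete zero ρ)) (sym x≡y))))
  where
  x≡y : τ ⟨$⟩ʳ zero ≡ ρ ⟨$⟩ʳ zero
  x≡y = trans (sym (arcLength-involutive a _)) (trans (cong (arcLength a) q) (arcLength-involutive a _))

fromCyclicCode : Fin (suc n) → Code n → Permutation′ n
fromCyclicCode a []      = Perm.id
fromCyclicCode a (e ∷ c) = insert zero (arcLength a e) (fromCyclicCode (arcLength a e) c)

cyclicCode-fromCyclicCode : (a : Fin (suc n)) (c : Code n) → cyclicCode a (fromCyclicCode a c) ≡ c
cyclicCode-fromCyclicCode a []      = refl
cyclicCode-fromCyclicCode a (e ∷ c) = cong₂ _∷_ (arcLength-involutive a e)
  (trans (cyclicCode-cong x (delete zero (insert zero x (fromCyclicCode x c))) (fromCyclicCode x c) (delete-insert zero x (fromCyclicCode x c))) (cyclicCode-fromCyclicCode x c))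
  where x = arcLength a e

-- The code of a zigzag word

orient : Bool → Fin n → Fin n
orient b i = if b then opposite i else i

orient-involutive : ∀ b (i : Fin n) → orient b (orient b i) ≡ i
orient-involutive true  i = Fin.opposite-involutive i
orient-involutive false i = refl

lastLetter : Code n → Fin (suc n) → Fin (suc n)
lastLetter c e = orient (ascending c) (proj₁ (flip (ℕ.m≤n⇒m≤1+n (reach≤ c)) e))

lastCode : Code n → Fin (suc n) → Fin (suc n)
lastCode c v = proj₁ (flip (ℕ.m≤n⇒m≤1+n (reach≤ c)) (orient (ascending c) v))

lastCode-lastLetter : (c : Code n) (e : Fin (suc n)) → lastCode c (lastLetter c e) ≡ e
lastCode-lastLetter c e =
  trans (cong (λ i → proj₁ (flip _ i)) (orient-involutive (ascending c) _)) (flip-involutive _ e)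

lastLetter-lastCode : (c : Code n) (v : Fin (suc n)) → lastLetter c (lastCode c v) ≡ v
lastLetter-lastCode c v =
  trans (cong (orient (ascending c)) (flip-involutive _ _)) (orient-involutive (ascending c) v)

zigzagCode : Permutation′ n → Code n
zigzagCode {zero}  σ = []
zigzagCode {suc n} σ = lastCode c (σ ⟨$⟩ʳ fromℕ n) ∷ c
  where c = zigzagCode (delete (fromℕ n) σ)

zigzagCode-cong : (σ ρ : Permutation′ n) → σ ≈ ρ → zigzagCode σ ≡ zigzagCode ρ
zigzagCode-cong {zero}  σ ρ σ≈ρ = refl
zigzagCode-cong {suc n} σ ρ σ≈ρ =
  cong₂ (λ c v → lastCode c v ∷ c) (zigzagCode-cong (delete (fromℕ n) σ) (delete (fromℕ n) ρ) (delete-cong (fromℕ n) σ ρ σ≈ρ)) (σ≈ρ (fromℕ n))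

zigzagCode-injective : (σ ρ : Permutation′ n) → zigzagCode σ ≡ zigzagCode ρ → σ ≈ ρ
zigzagCode-injective {suc n} σ ρ p with ∷-injective p
... | q , r = delete-injective (fromℕ n) σ ρ
  (trans (sym (lastLetter-lastCode (zigzagCode (delete (fromℕ n) σ)) _))
    (trans (cong₂ lastLetter r q) (lastLetter-lastCode (zigzagCode (delete (fromℕ n) ρ)) _)))
  (zigzagCode-injective (delete (fromℕ n) σ) (delete (fromℕ n) ρ) r)

fromZigzagCode : Code n → Permutation′ n
fromZigzagCode []            = Perm.id
fromZigzagCode (_∷_ {n} e c) = insert (fromℕ n) (lastLetter c e) (fromZigzagCode c)

insert-hit : (i j : Fin (suc n)) (π : Permutation′ n) → insert i j π ⟨$⟩ʳ i ≡ j
insert-hit i j π with i Fin.≟ i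
... | yes _  = refl
... | no i≢i = contradiction refl i≢i

zigzagCode-fromZigzagCode : (c : Code n) → zigzagCode (fromZigzagCode c) ≡ c
zigzagCode-fromZigzagCode []              = refl
zigzagCode-fromZigzagCode (_∷_ {n} e c) = begin
  zigzagCode (insert (fromℕ n) v π)
    ≡⟨ cong₂ (λ d w → lastCode d w ∷ d) (zigzagCode-cong (delete (fromℕ n) (insert (fromℕ n) v π)) π (delete-insert (fromℕ n) v π)) (insert-hit (fromℕ n) v π) ⟩
  lastCode (zigzagCode π) v ∷ zigzagCode π
    ≡⟨ cong (λ d → lastCode d v ∷ d) (zigzagCode-fromZigzagCode c) ⟩
  lastCode c v ∷ c
    ≡⟨ cong (_∷ c) (lastCode-lastLetter c e) ⟩
  e ∷ c ∎
  where
  open ≡-Reasoning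
  v = lastLetter c e
  π = fromZigzagCode c

-- Sums and comparisons

indicator : Bool → ℕ
indicator b = if b then 1 else 0

∑-zero : (f : Fin n → ℕ) → (∀ i → f i ≡ 0) → ∑ f ≡ 0
∑-zero {n} f f≡0 = trans (sum-cong-≗ f≡0) (sum-replicate-zero n)

count-tabulate : {P : Pred A 0ℓ} (P? : Decidable P) (f : Fin n → A) →
                 count P? (tabulate f) ≡ ∑ (λ i → indicator (does (P? (f i))))
count-tabulate {n = zero}  P? f = refl
count-tabulate {n = suc n} P? f with does (P? (f zero))
... | true  = cong suc (count-tabulate P? (f ∘ suc))
... | false = count-tabulate P? (f ∘ suc)

count-++ : {P : Pred A 0ℓ} (P? : Decidable P) (xs ys : List A) → count P? (xs ++ ys) ≡ count P? xs + count P? ys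
count-++ P? xs ys = trans (cong length (List.filter-++ P? xs ys)) (List.length-++ (filter P? xs))

count-cartesianProduct :
  {P : Pred (A × B) 0ℓ} (P? : Decidable P) (f : Fin m → A) (g : Fin n → B) →
  count P? (cartesianProduct (tabulate f) (tabulate g)) ≡ ∑ (λ i → ∑ (λ j → indicator (does (P? (f i , g j)))))
count-cartesianProduct {m = zero}  P? f g = refl
count-cartesianProduct {m = suc m} P? f g =
  trans (count-++ P? (List.map (f zero ,_) (tabulate g)) _)
    (cong₂ _+_
      (trans (cong (count P?) (List.map-tabulate g (f zero ,_))) (count-tabulate P? (λ j → f zero , g j)))
      (count-cartesianProduct P? (f ∘ suc) g))

∑-interval : ∀ l h → h ≤ n → ∑ {n} (λ u → indicator ((l <ᵇ suc (toℕ u)) ∧ (toℕ u <ᵇ h))) ≡ h ∸ l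
∑-interval {n}     l       zero    _         =
  trans (∑-zero {n} _ (λ u → false-end (l <ᵇ suc (toℕ u)))) (sym (ℕ.0∸n≡0 l))
  where
  false-end : ∀ b → indicator (b ∧ false) ≡ 0
  false-end true  = refl
  false-end false = refl
∑-interval {suc n} zero    (suc h) (s≤s h≤n) = cong suc (∑-interval zero h h≤n)
∑-interval {suc n} (suc l) (suc h) (s≤s h≤n) = ∑-interval l h h≤n

_<ᶠ_ : Fin m → Fin n → Bool
i <ᶠ j = toℕ i <ᵇ toℕ j

punchIn-<ᶠ : (v : Fin (suc n)) (x y : Fin n) → (punchIn v x <ᶠ punchIn v y) ≡ (x <ᶠ y)
punchIn-<ᶠ zero    x       y       = refl
punchIn-<ᶠ (suc v) zero    zero    = refl
punchIn-<ᶠ (suc v) zero    (suc y) = refl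
punchIn-<ᶠ (suc v) (suc x) zero    = refl
punchIn-<ᶠ (suc v) (suc x) (suc y) = punchIn-<ᶠ v x y

punchIn<ᶠhole : (v : Fin (suc n)) (x : Fin n) → (punchIn v x <ᶠ v) ≡ (x <ᶠ v)
punchIn<ᶠhole zero    x       = refl
punchIn<ᶠhole (suc v) zero    = refl
punchIn<ᶠhole (suc v) (suc x) = punchIn<ᶠhole v x

hole<ᶠpunchIn : (v : Fin (suc n)) (x : Fin n) → (v <ᶠ punchIn v x) ≡ (v <ᶠ suc x)
hole<ᶠpunchIn zero    x       = refl
hole<ᶠpunchIn (suc v) zero    = refl
hole<ᶠpunchIn (suc v) (suc x) = hole<ᶠpunchIn v x

<⇒<ᵇ≡true : ∀ {k l} → k < l → (k <ᵇ l) ≡ true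
<⇒<ᵇ≡true {k} {l} k<l with k <ᵇ l | compare k l
... | _ | less _      = refl
... | _ | notLess l≤k = contradiction k<l (ℕ.≤⇒≯ l≤k)

≤⇒<ᵇ≡false : ∀ {k l} → l ≤ k → (k <ᵇ l) ≡ false
≤⇒<ᵇ≡false {k} {l} l≤k with k <ᵇ l | compare k l
... | _ | less k<l  = contradiction k<l (ℕ.≤⇒≯ l≤k)
... | _ | notLess _ = refl

punchIn-fromℕ : (i : Fin n) → punchIn (fromℕ n) i ≡ inject₁ i
punchIn-fromℕ zero    = refl
punchIn-fromℕ (suc i) = cong suc (punchIn-fromℕ i)

pred-inject₁ : (i : Fin (suc n)) → pred (inject₁ i) ≡ inject₁ (pred i)
pred-inject₁ zero    = refl
pred-inject₁ (suc i) = refl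

-- The comparisons occurring in the definitions of ThreeInversion and of
-- DoubleAscent and DoubleDescent, at positions q, p and j standing for
-- pred (pred j), pred j and j.

isThreeInversion : (Fin n → Fin n → Bool) → ℕ → ℕ → Fin n → Fin n → Fin n → Fin n → Bool
isThreeInversion _≺_ i′ j′ q p j i =
  (1 ≤ᵇ i′) ∧ (i′ <ᵇ j′) ∧
    (    (((2 ≤ᵇ j′) ∧ (q ≺ p) ∧ (p ≺ j)) ∧ (p ≺ i) ∧ (i ≺ j))
    ∨ ((((2 ≤ᵇ j′) ∧ (p ≺ q) ∧ (j ≺ p)) ∧ (i ≺ p) ∧ (j ≺ i))
    ∨ ((((2 ≤ᵇ j′) ∧ (q ≺ p) ∧ (j ≺ p)) ∧ (j ≺ i))
    ∨  (((2 ≤ᵇ j′) ∧ (p ≺ q) ∧ (p ≺ j)) ∧ (i ≺ j)))))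

isMonotone : (Fin n → Fin n → Bool) → ℕ → Fin n → Fin n → Fin n → Bool
isMonotone _≺_ j′ q p j =
  ((2 ≤ᵇ j′) ∧ (q ≺ p) ∧ (p ≺ j)) ∨ ((2 ≤ᵇ j′) ∧ (p ≺ q) ∧ (j ≺ p))

module _ (f : Fin m → Fin n) (_≺_ : Fin n → Fin n → Bool) (_≺′_ : Fin m → Fin m → Bool)
         (f-≺ : ∀ p q → (f p ≺ f q) ≡ (p ≺′ q)) where

  isThreeInversion-invariant : ∀ i′ j′ q p j i →
    isThreeInversion _≺_ i′ j′ (f q) (f p) (f j) (f i) ≡ isThreeInversion _≺′_ i′ j′ q p j i
  isThreeInversion-invariant i′ j′ q p j i
    rewrite f-≺ q p | f-≺ p q | f-≺ p j | f-≺ j p | f-≺ p i | f-≺ i p | f-≺ i j | f-≺ j i = refl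

  isMonotone-invariant : ∀ j′ q p j →
    isMonotone _≺_ j′ (f q) (f p) (f j) ≡ isMonotone _≺′_ j′ q p j
  isMonotone-invariant j′ q p j
    rewrite f-≺ q p | f-≺ p q | f-≺ p j | f-≺ j p = refl

-- Effect of the last letter on `inv₃` and `monot`

_≺[_]_ : Fin (suc n) → Permutation′ n → Fin (suc n) → Bool
p ≺[ σ ] q = letter σ p <ᶠ letter σ q

threeInversion : Permutation′ n → Fin (suc n) → Fin (suc n) → Bool
threeInversion σ i j = isThreeInversion (_≺[ σ ]_) (toℕ i) (toℕ j) (pred (pred j)) (pred j) j i

monotone : Permutation′ n → Fin (suc n) → Bool
monotone σ j = isMonotone (_≺[ σ ]_) (toℕ j) (pred (pred j)) (pred j) j

inv₃-∑ : (σ : Permutation′ n) → inv₃ σ ≡ ∑ (λ i → ∑ (λ j → indicator (threeInversion σ i j)))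
inv₃-∑ σ = count-cartesianProduct (uncurry (threeInversion? σ)) id id

monot-∑ : (σ : Permutation′ n) → monot σ ≡ ∑ (λ j → indicator (monotone σ j))
monot-∑ {n} σ = count-tabulate {n = suc n} (λ j → doubleAscent? σ j ⊎-dec doubleDescent? σ j) id

module _ (σ : Permutation′ (suc n)) where

  private
    v : Fin (suc n)
    v = σ ⟨$⟩ʳ fromℕ n

    π : Permutation′ n
    π = delete (fromℕ n) σ

    last : Fin (suc (suc n))
    last = suc (fromℕ n)

  permute-inject₁ : (k : Fin n) → σ ⟨$⟩ʳ inject₁ k ≡ punchIn v (π ⟨$⟩ʳ k)
  permute-inject₁ k = trans (cong (σ ⟨$⟩ʳ_) (sym (punchIn-fromℕ k))) (permute-punchIn (fromℕ n) σ k)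

  letter-inject₁ : (k : Fin (suc n)) → letter σ (inject₁ k) ≡ punchIn (suc v) (letter π k)
  letter-inject₁ zero    = refl
  letter-inject₁ (suc k) = cong suc (permute-inject₁ k)

  ≺-inject₁ : ∀ p q → (inject₁ p ≺[ σ ] inject₁ q) ≡ (p ≺[ π ] q)
  ≺-inject₁ p q = trans (cong₂ _<ᶠ_ (letter-inject₁ p) (letter-inject₁ q)) (punchIn-<ᶠ (suc v) (letter π p) (letter π q))

  threeInversion-inject₁ : ∀ i j → threeInversion σ (inject₁ i) (inject₁ j) ≡ threeInversion π i j
  threeInversion-inject₁ i j
    rewrite pred-inject₁ j | pred-inject₁ (pred j) | Fin.toℕ-inject₁ i | Fin.toℕ-inject₁ j
    = isThreeInversion-invariant inject₁ (_≺[ σ ]_) (_≺[ π ]_) ≺-inject₁ (toℕ i) (toℕ j) (pred (pred j)) (pred j) j i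

  monotone-inject₁ : ∀ j → monotone σ (inject₁ j) ≡ monotone π j
  monotone-inject₁ j
    rewrite pred-inject₁ j | pred-inject₁ (pred j) | Fin.toℕ-inject₁ j
    = isMonotone-invariant inject₁ (_≺[ σ ]_) (_≺[ π ]_) ≺-inject₁ (toℕ j) (pred (pred j)) (pred j) j

  threeInversion-last : ∀ j → threeInversion σ last j ≡ false
  threeInversion-last j
    rewrite ≤⇒<ᵇ≡false {toℕ last} {toℕ j}
              (subst (toℕ j ≤_) (cong suc (sym (Fin.toℕ-fromℕ n))) (Fin.toℕ≤pred[n] j)) = refl

  -- Pairs of earlier positions are judged by comparisons alone, which survive the removal of the
  -- last letter, and the last position is never the first component of a pair.
  inv₃-step : inv₃ σ ≡ ∑ (λ i → indicator (threeInversion σ (inject₁ i) last)) + inv₃ π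
  inv₃-step = begin
    inv₃ σ                              ≡⟨ inv₃-∑ σ ⟩
    ∑ (λ i → ∑ (t i))                   ≡⟨ sum-init-last (λ i → ∑ (t i)) ⟩
    ∑ (λ i → ∑ (t (inject₁ i))) + ∑ (t last)
      ≡⟨ cong₂ _+_ (sum-cong-≗ (λ i → sum-init-last (t (inject₁ i))))
                   (∑-zero (t last) (λ j → cong indicator (threeInversion-last j))) ⟩
    ∑ (λ i → ∑ (λ j → t (inject₁ i) (inject₁ j)) + t (inject₁ i) last) + 0
      ≡⟨ ℕ.+-identityʳ _ ⟩
    ∑ (λ i → ∑ (λ j → t (inject₁ i) (inject₁ j)) + t (inject₁ i) last)
      ≡⟨ ∑-distrib-+ (λ i → ∑ (λ j → t (inject₁ i) (inject₁ j))) (λ i → t (inject₁ i) last) ⟩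
    ∑ (λ i → ∑ (λ j → t (inject₁ i) (inject₁ j))) + ∑ (λ i → t (inject₁ i) last)
      ≡⟨ cong (_+ ∑ (λ i → t (inject₁ i) last))
           (trans (sum-cong-≗ (λ i → sum-cong-≗ (λ j → cong indicator (threeInversion-inject₁ i j)))) (sym (inv₃-∑ π))) ⟩
    inv₃ π + ∑ (λ i → t (inject₁ i) last)
      ≡⟨ ℕ.+-comm (inv₃ π) _ ⟩
    ∑ (λ i → t (inject₁ i) last) + inv₃ π ∎
    where
    open ≡-Reasoning
    t : Fin (suc (suc n)) → Fin (suc (suc n)) → ℕ
    t i j = indicator (threeInversion σ i j)

  monot-step : monot σ ≡ indicator (monotone σ last) + monot π
  monot-step = begin
    monot σ ≡⟨ monot-∑ σ ⟩
    ∑ (indicator ∘ monotone σ) ≡⟨ sum-init-last (indicator ∘ monotone σ) ⟩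
    ∑ (indicator ∘ monotone σ ∘ inject₁) + indicator (monotone σ last)
      ≡⟨ cong (_+ indicator (monotone σ last))
           (trans (sum-cong-≗ (λ j → cong indicator (monotone-inject₁ j))) (sym (monot-∑ π))) ⟩
    monot π + indicator (monotone σ last) ≡⟨ ℕ.+-comm (monot π) _ ⟩
    indicator (monotone σ last) + monot π ∎
    where open ≡-Reasoning

-- Statistics of the zigzag permutation

-- Position of the last letter v of a permutation of length m, whose code has
-- reach s, according to the direction of its last step.

Final : Bool → (m v s : ℕ) → Set
Final true  m v s = s + v ≡ m
Final false m v s = s ≡ suc v

-- `v` is numbered among the `m` earlier letters and `w` among all `m + 1`, so that the last step
-- goes up exactly if `v < w`. The value of `e` is the number of 3-inversions at the last position.
data Extension (m v w e : ℕ) : Bool → Bool → Set where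
  ascent  : v < w → e ≡ w ∸ suc v → Extension m v w e true true
  peak    : w ≤ v → e ≡ m ∸ w     → Extension m v w e true false
  descent : w ≤ v → e ≡ v ∸ w     → Extension m v w e false true
  valley  : v < w → e ≡ w         → Extension m v w e false false

Oriented : Bool → (m u w : ℕ) → Set
Oriented true  m u w = u + w ≡ m
Oriented false m u w = u ≡ w

oriented : ∀ b (w : Fin (suc m)) → Oriented b m (toℕ (orient b w)) (toℕ w)
oriented {m} true  w = trans (cong (_+ toℕ w) (Fin.opposite-prop w)) (ℕ.m∸n+n≡m (Fin.toℕ≤pred[n] w))
oriented     false w = refl

below⇒e<s : ∀ {e u s} → e + suc u ≡ s → e < s
below⇒e<s {e} {u} p = ℕ.≤-trans (ℕ.m≤m+n (suc e) u) (ℕ.≤-reflexive (trans (sym (ℕ.+-suc e u)) p))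

-- `Final` and `Oriented` both measure from the end of the values that lies in the current
-- direction, so comparing `u` with the reach `r` compares `w` with `v`. Since `Flip` keeps each
-- side of `r`, the combinations of `below` with `long` and of `above` with `short` are impossible.
extension : ∀ {m v w u} {e r s d b′} b →
            Final b m v r → Oriented b m u w → Flip r u e → ReachStep m e r b s d b′ →
            Extension m v w e b d × Final b′ (suc m) w s
extension b _ _ (below _ p) (long s≤e _) = contradiction (below⇒e<s p) (ℕ.≤⇒≯ s≤e)
extension b _ _ (above s≤u refl) (short e<s _) = contradiction e<s (ℕ.≤⇒≯ s≤u)
extension {m} {v} {w} {u} {e} {r} true fin ori (below u<s p) (short {s} e<s q) =
  ascent v<w (ℕ.+-cancelʳ-≡ (suc v) _ _ (trans (trans (ℕ.+-suc e v) e+v≡w) (sym (ℕ.m∸n+n≡m v<w)))) ,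
  trans (cong (_+ w) s≡1+u) (cong suc ori)
  where
  s≡1+u : s ≡ suc u
  s≡1+u = ℕ.+-cancelʳ-≡ e s (suc u) (trans q (trans (sym p) (ℕ.+-comm e (suc u))))
  v<w : v < w
  v<w = ℕ.≰⇒> (λ w≤v → ℕ.<⇒≢ (ℕ.+-mono-<-≤ u<s w≤v) (trans ori (sym fin)))
  e+v≡w : suc (e + v) ≡ w
  e+v≡w = ℕ.+-cancelˡ-≡ u _ _ (begin
    u + suc (e + v)  ≡⟨ ℕ.+-suc u _ ⟩
    suc u + (e + v)  ≡⟨ ℕ.+-assoc (suc u) e v ⟨
    suc u + e + v    ≡⟨ cong (_+ v) (trans (ℕ.+-comm (suc u) e) p) ⟩
    r + v          ≡⟨ fin ⟩
    m                    ≡⟨ ori ⟨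
    u + w                ∎)
    where open ≡-Reasoning
extension {m} {v} {w} {u} {e} {r} true fin ori (above s≤u refl) (long {s} _ q) =
  peak w≤v (trans (sym (ℕ.m+n∸n≡m u w)) (cong (_∸ w) ori)) ,
  ℕ.+-cancelʳ-≡ e s (suc w) (trans q (cong suc (trans (sym ori) (ℕ.+-comm u w))))
  where
  w≤v : w ≤ v
  w≤v = ℕ.≮⇒≥ (λ v<w → ℕ.<⇒≢ (ℕ.+-mono-≤-< s≤u v<w) (trans fin (sym ori)))
extension {m} {v} {w} {u} {e} {r} false fin refl (below u<s p) (short {s} e<s q) =
  descent w≤v (ℕ.+-cancelʳ-≡ w _ _ (trans (ℕ.suc-injective (trans (sym (ℕ.+-suc e w)) (trans p fin))) (sym (ℕ.m∸n+n≡m w≤v)))) ,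
  ℕ.+-cancelʳ-≡ e s (suc w) (trans q (trans (sym p) (ℕ.+-comm e (suc w))))
  where
  w≤v : w ≤ v
  w≤v = ℕ.s≤s⁻¹ (subst (w <_) fin u<s)
extension {m} {v} {w} {u} {e} false fin refl (above s≤u refl) (long {s} _ q) =
  valley (subst (_≤ w) fin s≤u) refl , q

direction : ∀ {m v w e r s b d b′} → Extension m v w e b d → ReachStep m e r b s d b′ → b′ ≡ (v <ᵇ w)
direction (ascent v<w _)  (short _ _) = sym (<⇒<ᵇ≡true v<w)
direction (peak w≤v _)    (long _ _)  = sym (≤⇒<ᵇ≡false w≤v)
direction (descent w≤v _) (short _ _) = sym (≤⇒<ᵇ≡false w≤v)
direction (valley v<w _)  (long _ _)  = sym (<⇒<ᵇ≡true v<w)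

-- The 3-inversions (i , j) at the last position j, where v and w are the last
-- two letters and u + 1 or u is the letter in position i, depending on
-- whether w ≤ u.

lastInversion : Bool → Bool → (v w u : ℕ) → Bool
lastInversion up down v w u =
     ((up ∧ (v <ᵇ w)) ∧ (v <ᵇ u) ∧ (u <ᵇ w))
  ∨ (((down ∧ (w <ᵇ suc v)) ∧ (u <ᵇ v) ∧ (w <ᵇ suc u))
  ∨ (((up ∧ (w <ᵇ suc v)) ∧ (w <ᵇ suc u))
  ∨  ((down ∧ (v <ᵇ w)) ∧ (u <ᵇ w))))

∑-lastInversion : ∀ {m v w e b d} → Extension m v w e b d → v < m → w ≤ m →
                  ∑ {m} (λ u → indicator (lastInversion b (not b) v w (toℕ u))) ≡ e
∑-lastInversion {m} {v} {w} (ascent v<w refl) _ w≤m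
  rewrite <⇒<ᵇ≡true v<w | ≤⇒<ᵇ≡false {w} {suc v} v<w =
  trans (sum-cong-≗ {m} (λ u → cong indicator (∨-identityʳ _))) (∑-interval (suc v) w w≤m)
∑-lastInversion {m} {v} {w} (peak w≤v refl) _ _
  rewrite ≤⇒<ᵇ≡false w≤v | <⇒<ᵇ≡true (s≤s w≤v) =
  -- A peak is inverted with all letters from `w` upwards; the bound `u < m` is inserted to give the
  -- summand the shape of an interval.
  trans (sum-cong-≗ {m} (λ u → cong indicator (trans (∨-identityʳ _)
          (trans (sym (∧-identityʳ _)) (cong ((w <ᵇ suc (toℕ u)) ∧_) (sym (<⇒<ᵇ≡true (Fin.toℕ<n u))))))))
    (∑-interval w m ℕ.≤-refl)
∑-lastInversion {m} {v} {w} (descent w≤v refl) v<m _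
  rewrite ≤⇒<ᵇ≡false w≤v | <⇒<ᵇ≡true (s≤s w≤v) =
  trans (sum-cong-≗ {m} (λ u → cong indicator (trans (∨-identityʳ _) (∧-comm (toℕ u <ᵇ v) _))))
    (∑-interval w v (ℕ.<⇒≤ v<m))
∑-lastInversion {m} {v} {w} (valley v<w refl) _ w≤m
  rewrite <⇒<ᵇ≡true v<w | ≤⇒<ᵇ≡false {w} {suc v} v<w =
  ∑-interval 0 w w≤m

lastMonotone : ∀ {m v w e b d} → Extension m v w e b d →
               ((b ∧ (v <ᵇ w)) ∨ (not b ∧ (w <ᵇ suc v))) ≡ d
lastMonotone (ascent v<w _)  rewrite <⇒<ᵇ≡true v<w = refl
lastMonotone (peak w≤v _)    rewrite ≤⇒<ᵇ≡false w≤v = refl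
lastMonotone (descent w≤v _) = <⇒<ᵇ≡true (s≤s w≤v)
lastMonotone (valley v<w _)  = ≤⇒<ᵇ≡false v<w

<ᶠ-asym : {i j : Fin n} → i ≢ j → (j <ᶠ i) ≡ not (i <ᶠ j)
<ᶠ-asym {i = i} {j} i≢j with toℕ i <ᵇ toℕ j | compare (toℕ i) (toℕ j)
... | _ | less i<j    = ≤⇒<ᵇ≡false (ℕ.<⇒≤ i<j)
... | _ | notLess j≤i = <⇒<ᵇ≡true (ℕ.≤∧≢⇒< j≤i (λ p → i≢j (Fin.toℕ-injective (sym p))))

permute-injective : (π : Permutation′ n) {i j : Fin n} → π ⟨$⟩ʳ i ≡ π ⟨$⟩ʳ j → i ≡ j
permute-injective π = Injection.injective (↔⇒↣ π)

rising : Permutation′ (suc n) → Bool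
rising {n} σ = pred (suc (fromℕ n)) ≺[ σ ] suc (fromℕ n)

falling : Permutation′ (suc n) → Bool
falling {n} σ = suc (fromℕ n) ≺[ σ ] pred (suc (fromℕ n))

falling≡¬rising : (σ : Permutation′ (suc n)) → falling σ ≡ not (rising σ)
falling≡¬rising {n} σ = <ᶠ-asym {i = letter σ (inject₁ (fromℕ n))} {letter σ (suc (fromℕ n))}
  (λ p → inject₁≢suc (fromℕ n) (permute-injective (lift₀ σ) p))
  where
  inject₁≢suc : (i : Fin m) → inject₁ i ≢ suc i
  inject₁≢suc i p = ℕ.1+n≢n (trans (sym (cong toℕ p)) (Fin.toℕ-inject₁ i))

module _ (σ : Permutation′ (suc (suc n))) where

  private
    w : Fin (suc (suc n))
    w = σ ⟨$⟩ʳ fromℕ (suc n)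

    π : Permutation′ (suc n)
    π = delete (fromℕ (suc n)) σ

    v : Fin (suc n)
    v = π ⟨$⟩ʳ fromℕ n

    last : Fin (suc (suc (suc n)))
    last = suc (fromℕ (suc n))

    ≺last : (k : Fin (suc n)) → (inject₁ (suc k) ≺[ σ ] last) ≡ ((π ⟨$⟩ʳ k) <ᶠ w)
    ≺last k = trans (cong (_<ᶠ w) (permute-inject₁ σ k)) (punchIn<ᶠhole w (π ⟨$⟩ʳ k))

    last≺ : (k : Fin (suc n)) → (last ≺[ σ ] inject₁ (suc k)) ≡ (w <ᶠ suc (π ⟨$⟩ʳ k))
    last≺ k = trans (cong (w <ᶠ_) (permute-inject₁ σ k)) (hole<ᶠpunchIn w (π ⟨$⟩ʳ k))

  rising-last : rising σ ≡ (v <ᶠ w)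
  rising-last = ≺last (fromℕ n)

  monotone-last : monotone σ last ≡ ((rising π ∧ (v <ᶠ w)) ∨ (falling π ∧ (w <ᶠ suc v)))
  monotone-last
    rewrite ≺-inject₁ σ (inject₁ (fromℕ n)) (suc (fromℕ n)) | ≺-inject₁ σ (suc (fromℕ n)) (inject₁ (fromℕ n))
          | ≺last (fromℕ n) | last≺ (fromℕ n) = refl

  threeInversion-inject₁-last : ∀ k → threeInversion σ (inject₁ (suc k)) last ≡
    lastInversion (rising π) (falling π) (toℕ v) (toℕ w) (toℕ (π ⟨$⟩ʳ k))
  threeInversion-inject₁-last k
    rewrite <⇒<ᵇ≡true {toℕ (inject₁ k)} {toℕ (fromℕ (suc n))}
              (ℕ.≤-trans (s≤s (ℕ.≤-trans (ℕ.≤-reflexive (Fin.toℕ-inject₁ k)) (Fin.toℕ≤pred[n] k)))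
                         (s≤s (ℕ.≤-reflexive (sym (Fin.toℕ-fromℕ n)))))
          | ≺-inject₁ σ (inject₁ (fromℕ n)) (suc (fromℕ n)) | ≺-inject₁ σ (suc (fromℕ n)) (inject₁ (fromℕ n))
          | ≺last (fromℕ n) | last≺ (fromℕ n)
          | ≺-inject₁ σ (suc (fromℕ n)) (suc k) | ≺-inject₁ σ (suc k) (suc (fromℕ n))
          | ≺last k | last≺ k = refl

  module _ {e b d} (x : Extension (suc n) (toℕ v) (toℕ w) e b d) (b≡rising : b ≡ rising π) where

    inv₃-last : inv₃ σ ≡ e + inv₃ π
    inv₃-last = trans (inv₃-step σ) (cong (_+ inv₃ π) (begin
      -- The summand of position 0 has vanished by computation, because of the test `1 ≤ᵇ 0`.
      ∑ (λ k → indicator (threeInversion σ (inject₁ (suc k)) last))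
        ≡⟨ sum-cong-≗ {suc n} (λ k → cong indicator (threeInversion-inject₁-last k)) ⟩
      ∑ (λ k → indicator (lastInversion (rising π) (falling π) (toℕ v) (toℕ w) (toℕ (π ⟨$⟩ʳ k))))
        -- The summand depends on the position only through its letter, so the sum may run over
        -- letters.
        ≡⟨ sum-permute (λ u → indicator (lastInversion (rising π) (falling π) (toℕ v) (toℕ w) (toℕ u))) π ⟨
      ∑ {suc n} (λ u → indicator (lastInversion (rising π) (falling π) (toℕ v) (toℕ w) (toℕ u)))
        ≡⟨ cong₂ (λ r f → ∑ {suc n} (λ u → indicator (lastInversion r f (toℕ v) (toℕ w) (toℕ u))))
             (sym b≡rising) (trans (falling≡¬rising π) (cong not (sym b≡rising))) ⟩
      ∑ {suc n} (λ u → indicator (lastInversion b (not b) (toℕ v) (toℕ w) (toℕ u)))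
        ≡⟨ ∑-lastInversion x (Fin.toℕ<n v) (Fin.toℕ≤pred[n] w) ⟩
      e ∎))
      where open ≡-Reasoning

    monot-last : monot σ ≡ indicator d + monot π
    monot-last = trans (monot-step σ) (cong (λ d → indicator d + monot π) (begin
      monotone σ last
        ≡⟨ monotone-last ⟩
      (rising π ∧ (v <ᶠ w)) ∨ (falling π ∧ (w <ᶠ suc v))
        ≡⟨ cong₂ (λ r f → (r ∧ (v <ᶠ w)) ∨ (f ∧ (w <ᶠ suc v)))
             (sym b≡rising) (trans (falling≡¬rising π) (cong not (sym b≡rising))) ⟩
      (b ∧ (v <ᶠ w)) ∨ (not b ∧ (w <ᶠ suc v))
        ≡⟨ lastMonotone x ⟩
      d ∎))
      where open ≡-Reasoning

toℕ-Fin1 : (i : Fin 1) → toℕ i ≡ 0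
toℕ-Fin1 zero = refl

zigzag-extension :
  (σ : Permutation′ (suc (suc n))) →
  let π = delete (fromℕ (suc n)) σ
      c = zigzagCode π
      w = σ ⟨$⟩ʳ fromℕ (suc n)
      e = lastCode c w in
  Final (ascending c) (suc n) (toℕ (π ⟨$⟩ʳ fromℕ n)) (reach c) →
  Extension (suc n) (toℕ (π ⟨$⟩ʳ fromℕ n)) (toℕ w) (toℕ e) (ascending c) (decorations (e ∷ c) zero)
  × Final (ascending (e ∷ c)) (suc (suc n)) (toℕ w) (reach (e ∷ c))
zigzag-extension {n} σ final =
  extension (ascending c) final (oriented (ascending c) w)
    (proj₂ (flip (ℕ.m≤n⇒m≤1+n (reach≤ c)) (orient (ascending c) w))) (reachStep (lastCode c w) c)
  where
  c = zigzagCode (delete (fromℕ (suc n)) σ)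
  w = σ ⟨$⟩ʳ fromℕ (suc n)

zigzag-final : (σ : Permutation′ (suc n)) → let c = zigzagCode σ in
  ascending c ≡ rising σ × Final (ascending c) (suc n) (toℕ (σ ⟨$⟩ʳ fromℕ n)) (reach c)
zigzag-final {zero} σ
  rewrite toℕ-Fin1 (lastCode [] (σ ⟨$⟩ʳ zero)) | toℕ-Fin1 (σ ⟨$⟩ʳ zero) = refl , refl
zigzag-final {suc n} σ =
  trans (direction (proj₁ x) (reachStep (lastCode c w) c)) (sym (rising-last σ)) , proj₂ x
  where
  c = zigzagCode (delete (fromℕ (suc n)) σ)
  w = σ ⟨$⟩ʳ fromℕ (suc n)
  x = zigzag-extension σ (proj₂ (zigzag-final (delete (fromℕ (suc n)) σ)))

inv₃-weight : (σ : Permutation′ n) → inv₃ σ ≡ weight (zigzagCode σ)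
inv₃-weight {zero}        σ = refl
inv₃-weight {suc zero}    σ rewrite toℕ-Fin1 (lastCode [] (σ ⟨$⟩ʳ zero)) = inv₃-step σ
inv₃-weight {suc (suc n)} σ = trans
  (inv₃-last σ (proj₁ (zigzag-extension σ (proj₂ (zigzag-final π)))) (proj₁ (zigzag-final π)))
  (cong (toℕ (lastCode (zigzagCode π) (σ ⟨$⟩ʳ fromℕ (suc n))) +_) (inv₃-weight π))
  where π = delete (fromℕ (suc n)) σ

monot-decorations : (σ : Permutation′ n) → monot σ ≡ ∑ (indicator ∘ decorations (zigzagCode σ))
monot-decorations {zero}        σ = refl
monot-decorations {suc zero}    σ = monot-step σ
monot-decorations {suc (suc n)} σ = trans
  (monot-last σ (proj₁ (zigzag-extension σ (proj₂ (zigzag-final π)))) (proj₁ (zigzag-final π)))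
  (cong (indicator (decorations (zigzagCode σ) zero) +_) (monot-decorations π))
  where π = delete (fromℕ (suc n)) σ

-- The major index

sum-filter-tabulate : {P : Pred A 0ℓ} (P? : Decidable P) (g : A → ℕ) (f : Fin n → A) →
  sum (List.map g (filter P? (tabulate f))) ≡ ∑ (λ i → g (f i) * indicator (does (P? (f i))))
sum-filter-tabulate {n = zero}  P? g f = refl
sum-filter-tabulate {n = suc n} P? g f with does (P? (f zero))
... | true  = cong₂ _+_ (sym (ℕ.*-identityʳ _)) (sum-filter-tabulate P? g (f ∘ suc))
... | false = trans (sum-filter-tabulate P? g (f ∘ suc)) (cong (_+ ∑ (λ i → g (f (suc i)) * indicator (does (P? (f (suc i)))))) (sym (ℕ.*-zeroʳ (g (f zero)))))

descentTerm : Permutation′ n → Fin n → ℕ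
descentTerm ρ i = toℕ i * indicator (suc i ≺[ ρ ] inject₁ i)

maj-∑ : (ρ : Permutation′ n) → maj ρ ≡ ∑ (descentTerm ρ)
maj-∑ {n} ρ = sum-filter-tabulate {n = n} (λ i → letter ρ (suc i) Fin.<? letter ρ (inject₁ i)) toℕ id

maj-cong : (π ρ : Permutation′ n) → π ≈ ρ → maj π ≡ maj ρ
maj-cong π ρ π≈ρ = trans (maj-∑ π) (trans (sum-cong-≗ (λ i → cong (λ b → toℕ i * indicator b)
  (cong₂ _<ᶠ_ (lift₀-cong π ρ π≈ρ (suc i)) (lift₀-cong π ρ π≈ρ (inject₁ i))))) (sym (maj-∑ ρ)))

maj-step : (ρ : Permutation′ (suc n)) → maj ρ ≡ maj (delete (fromℕ n) ρ) + n * indicator (falling ρ)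
maj-step {n} ρ = begin
  maj ρ                                               ≡⟨ maj-∑ ρ ⟩
  ∑ (descentTerm ρ)                                       ≡⟨ sum-init-last (descentTerm ρ) ⟩
  ∑ (descentTerm ρ ∘ inject₁) + descentTerm ρ (fromℕ n)
    ≡⟨ cong₂ _+_ (trans (sum-cong-≗ (λ i → cong₂ (λ k b → k * indicator b) (Fin.toℕ-inject₁ i) (≺-inject₁ ρ (suc i) (inject₁ i))))
                        (sym (maj-∑ (delete (fromℕ n) ρ))))
                 (cong (_* indicator (falling ρ)) (Fin.toℕ-fromℕ n)) ⟩
  maj (delete (fromℕ n) ρ) + n * indicator (falling ρ) ∎
  where open ≡-Reasoning

opposite-fromℕ : ∀ n → opposite (fromℕ n) ≡ zero
opposite-fromℕ n = Fin.opposite-involutive zero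

opposite-inject₁ : (i : Fin n) → opposite (inject₁ i) ≡ suc (opposite i)
opposite-inject₁ i = trans (cong (opposite ∘ inject₁) (sym (Fin.opposite-involutive i)))
                           (Fin.opposite-involutive (suc (opposite i)))

delete-reverse : (τ : Permutation′ (suc n)) → delete (fromℕ n) (reverse ∘ₚ τ) ≈ reverse ∘ₚ delete zero τ
delete-reverse {n} τ k = Fin.punchIn-injective (ρ ⟨$⟩ʳ fromℕ n) _ _ (begin
  punchIn (ρ ⟨$⟩ʳ fromℕ n) (delete (fromℕ n) ρ ⟨$⟩ʳ k)  ≡⟨ permute-inject₁ ρ k ⟨
  τ ⟨$⟩ʳ opposite (inject₁ k)                            ≡⟨ cong (τ ⟨$⟩ʳ_) (opposite-inject₁ k) ⟩
  τ ⟨$⟩ʳ suc (opposite k)                                ≡⟨ permute-punchIn zero τ (opposite k) ⟩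
  punchIn (τ ⟨$⟩ʳ zero) (delete zero τ ⟨$⟩ʳ opposite k)  ≡⟨ cong (λ i → punchIn (τ ⟨$⟩ʳ i) (delete zero τ ⟨$⟩ʳ opposite k)) (opposite-fromℕ n) ⟨
  punchIn (ρ ⟨$⟩ʳ fromℕ n) (delete zero τ ⟨$⟩ʳ opposite k) ∎)
  where
  open ≡-Reasoning
  ρ = reverse ∘ₚ τ

reverseMaj : Permutation′ n → ℕ
reverseMaj τ = maj (reverse ∘ₚ τ)

-- The first letter of `τ` ends the reversed word, where it creates the descent position `suc n` if
-- the second letter of `τ` is larger. The latter is renumbered by the deletion, hence the `suc` in
-- the comparison.
reverseMaj-step : (τ : Permutation′ (suc (suc n))) →
  reverseMaj τ ≡ reverseMaj (delete zero τ)
                 + suc n * indicator ((τ ⟨$⟩ʳ zero) <ᶠ suc (delete zero τ ⟨$⟩ʳ zero))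
reverseMaj-step {n} τ = trans (maj-step ρ) (cong₂ (λ k b → k + suc n * indicator b)
  (maj-cong _ _ (delete-reverse τ))
  (trans (cong₂ (λ i j → (τ ⟨$⟩ʳ i) <ᶠ (τ ⟨$⟩ʳ j)) (opposite-fromℕ (suc n)) (trans (opposite-inject₁ (fromℕ n)) (cong suc (opposite-fromℕ n))))
    (trans (cong ((τ ⟨$⟩ʳ zero) <ᶠ_) (permute-punchIn zero τ zero)) (hole<ᶠpunchIn (τ ⟨$⟩ʳ zero) (delete zero τ ⟨$⟩ʳ zero)))))
  where ρ = reverse ∘ₚ τ

indicator-split : ∀ m b → m ≡ m * indicator b + m * indicator (not b)
indicator-split m true  = sym (trans (cong₂ _+_ (ℕ.*-identityʳ m) (ℕ.*-zeroʳ m)) (ℕ.+-identityʳ m))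
indicator-split m false = sym (cong₂ _+_ (ℕ.*-zeroʳ m) (ℕ.*-identityʳ m))

-- The induction step of `weight-cyclicCode`. The equation in the hypothesis is the claim for the
-- remaining word with gap `x`, where `b` tells whether its first letter lies below that gap. If
-- not, the deleted letter adds the descent `m`; `indicator-split` balances these two alternatives.
weight-step : ∀ {m a x e} {W R : ℕ} b → Arc m a x e →
  W + m * indicator b ≡ R + x →
  (e + W) + suc m * indicator (x <ᵇ a) ≡ (R + m * indicator (not b)) + a
weight-step {m} {a} {x} {e} {W} {R} b (direct x<a p) q rewrite <⇒<ᵇ≡true x<a = begin
  e + W + suc m * 1                              ≡⟨ cong (λ k → e + W + k) (ℕ.*-identityʳ (suc m)) ⟩
  e + W + suc m                                  ≡⟨ cong (λ k → e + W + suc k) (indicator-split m b) ⟩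
  e + W + suc (m * i + m * i′)                   ≡⟨ regroup₁ e W (m * i) (m * i′) ⟩
  suc (e + (W + m * i) + m * i′)                 ≡⟨ cong (λ k → suc (e + k + m * i′)) q ⟩
  suc (e + (R + x) + m * i′)                     ≡⟨ regroup₂ e R x (m * i′) ⟩
  R + m * i′ + (e + suc x)                       ≡⟨ cong (R + m * i′ +_) p ⟩
  R + m * i′ + a                                 ∎
  where
  open ≡-Reasoning
  i  = indicator b
  i′ = indicator (not b)
  regroup₁ : ∀ e W k l → e + W + suc (k + l) ≡ suc (e + (W + k) + l)
  regroup₁ = solve-∀
  regroup₂ : ∀ e R x l → suc (e + (R + x) + l) ≡ R + l + (e + suc x)
  regroup₂ = solve-∀
weight-step {m} {a} {x} {e} {W} {R} b (wrapped a≤x p) q rewrite ≤⇒<ᵇ≡false a≤x =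
  ℕ.+-cancelʳ-≡ (m * i) _ _ (begin
  e + W + suc m * 0 + m * i                      ≡⟨ cong (λ k → e + W + k + m * i) (ℕ.*-zeroʳ (suc m)) ⟩
  e + W + 0 + m * i                              ≡⟨ regroup₁ e W (m * i) ⟩
  e + (W + m * i)                                ≡⟨ cong (e +_) q ⟩
  e + (R + x)                                    ≡⟨ regroup₂ e R x ⟩
  R + (e + x)                                    ≡⟨ cong (R +_) (trans p (cong (_+ a) (indicator-split m b))) ⟩
  R + (m * i + m * i′ + a)                       ≡⟨ regroup₃ R (m * i) (m * i′) a ⟩
  R + m * i′ + a + m * i                         ∎)
  where
  open ≡-Reasoning
  i  = indicator b
  i′ = indicator (not b)
  regroup₁ : ∀ e W k → e + W + 0 + k ≡ e + (W + k)
  regroup₁ = solve-∀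
  regroup₂ : ∀ e R x → e + (R + x) ≡ R + (e + x)
  regroup₂ = solve-∀
  regroup₃ : ∀ R k l a → R + (k + l + a) ≡ R + l + a + k
  regroup₃ = solve-∀

<ᶠsuc : (i : Fin m) (j : Fin n) → (i <ᶠ suc j) ≡ not (j <ᶠ i)
<ᶠsuc i j with toℕ j <ᵇ toℕ i | compare (toℕ j) (toℕ i)
... | _ | less j<i    = ≤⇒<ᵇ≡false j<i
... | _ | notLess i≤j = <⇒<ᵇ≡true (s≤s i≤j)

-- Rotating the values so that those below the gap a come last changes the
-- major index of the reversed word by a, up to a multiple of its length.

weight-cyclicCode : (a : Fin (suc (suc n))) (τ : Permutation′ (suc n)) →
  weight (cyclicCode a τ) + suc n * indicator ((τ ⟨$⟩ʳ zero) <ᶠ a) ≡ reverseMaj τ + toℕ a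
weight-cyclicCode {zero} a τ
  rewrite toℕ-Fin1 (arcLength a (τ ⟨$⟩ʳ zero)) | toℕ-Fin1 (τ ⟨$⟩ʳ zero) = gap a
  where
  gap : (a : Fin 2) → 1 * indicator (0 <ᵇ toℕ a) ≡ toℕ a
  gap zero       = refl
  gap (suc zero) = refl
weight-cyclicCode {suc n} a τ = begin
  weight (cyclicCode a τ) + suc (suc n) * indicator (x <ᶠ a)
    ≡⟨ weight-step (y <ᶠ x) (proj₂ (arc a x)) (weight-cyclicCode x (delete zero τ)) ⟩
  reverseMaj (delete zero τ) + suc n * indicator (not (y <ᶠ x)) + toℕ a
    ≡⟨ cong (λ b → reverseMaj (delete zero τ) + suc n * indicator b + toℕ a) (<ᶠsuc x y) ⟨
  reverseMaj (delete zero τ) + suc n * indicator (x <ᶠ suc y) + toℕ a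
    ≡⟨ cong (_+ toℕ a) (reverseMaj-step τ) ⟨
  reverseMaj τ + toℕ a ∎
  where
  open ≡-Reasoning
  x = τ ⟨$⟩ʳ zero
  y = delete zero τ ⟨$⟩ʳ zero

-- No letter lies below the gap `zero`, so both correction terms vanish.
reverseMaj-weight : (τ : Permutation′ n) → reverseMaj τ ≡ weight (cyclicCode zero τ)
reverseMaj-weight {zero}  τ = refl
reverseMaj-weight {suc n} τ = sym (begin
  weight (cyclicCode zero τ)              ≡⟨ ℕ.+-identityʳ _ ⟨
  weight (cyclicCode zero τ) + 0          ≡⟨ cong (weight (cyclicCode zero τ) +_) (ℕ.*-zeroʳ (suc n)) ⟨
  weight (cyclicCode zero τ) + suc n * 0  ≡⟨ weight-cyclicCode zero τ ⟩
  reverseMaj τ + 0                        ≡⟨ ℕ.+-identityʳ _ ⟩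
  reverseMaj τ                            ∎)
  where open ≡-Reasoning

-- Windows and unit schedules

advance : Bool → ℕ → ℕ
advance b r = if b then r else suc r

advance-mono : ∀ b {r s} → r ≤ s → advance b r ≤ advance b s
advance-mono true  p = p
advance-mono false p = s≤s p

advance-injective : ∀ b {r s} → advance b r ≡ advance b s → r ≡ s
advance-injective true  p = p
advance-injective false p = ℕ.suc-injective p

run : (Fin (suc n) → Fin N) → Fin (suc n) → ℕ
run         x zero    = 0
run {suc n} x (suc i) = advance (x (suc zero) <ᶠ x zero) (run (x ∘ suc) i)

-- The letter in position i lies in the window of the letter in position k:
-- walking downwards round the circle of values along the word, the step from
-- position i to position k stays short of a full turn.

Window : (Fin (suc n) → Fin N) → Fin (suc n) → Fin (suc n) → Set
Window x i k = (run x i ≡ run x k × x k Fin.< x i) ⊎ (suc (run x i) ≡ run x k × x i Fin.< x k)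

run-mono : (x : Fin (suc n) → Fin N) {i k : Fin (suc n)} → i Fin.≤ k → run x i ≤ run x k
run-mono         x {zero}          _         = z≤n
run-mono {suc n} x {suc i} {suc k} (s≤s i≤k) = advance-mono (x (suc zero) <ᶠ x zero) (run-mono (x ∘ suc) i≤k)

<ᶠ⇒< : {i : Fin m} {j : Fin n} → (i <ᶠ j) ≡ true → toℕ i < toℕ j
<ᶠ⇒< {i = i} {j} p with toℕ i <ᵇ toℕ j | compare (toℕ i) (toℕ j)
<ᶠ⇒< refl | _ | less i<j = i<j

run≡⇒> : (x : Fin (suc n) → Fin N) {i k : Fin (suc n)} → i Fin.< k → run x i ≡ run x k → x k Fin.< x i
run≡⇒> {suc n} x {zero} {suc k} _ p with x (suc zero) <ᶠ x zero in q
run≡⇒> {suc n} x {zero} {suc zero}    _ p | true = <ᶠ⇒< q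
run≡⇒> {suc n} x {zero} {suc (suc k)} _ p | true = ℕ.<-trans (run≡⇒> (x ∘ suc) {zero} {suc k} (s≤s z≤n) p) (<ᶠ⇒< q)
run≡⇒> {suc n} x {suc i} {suc k} (s≤s i<k) p = run≡⇒> (x ∘ suc) i<k (advance-injective (x (suc zero) <ᶠ x zero) p)

window⇒< : (x : Fin (suc n) → Fin N) {i k : Fin (suc n)} → Window x i k → i Fin.< k
window⇒< x {i} {k} w = ℕ.≰⇒> (impossible w)
  where
  impossible : Window x i k → ¬ (k Fin.≤ i)
  impossible (inj₂ (p , _)) k≤i = ℕ.<⇒≱ (ℕ.≤-reflexive p) (run-mono x k≤i)
  impossible (inj₁ (p , q)) k≤i with k Fin.≟ i
  ... | yes refl = ℕ.<-irrefl refl q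
  ... | no  k≢i  = ℕ.<-asym q (run≡⇒> x (ℕ.≤∧≢⇒< k≤i (k≢i ∘ Fin.toℕ-injective)) (sym p))

between : ∀ {r s t} → r ≤ s → s ≤ t → suc r ≡ t → s ≡ r ⊎ s ≡ t
between r≤s s≤t refl with ℕ.m≤n⇒m<n∨m≡n s≤t
... | inj₁ s<t = inj₁ (ℕ.≤-antisym (ℕ.s≤s⁻¹ s<t) r≤s)
... | inj₂ s≡t = inj₂ s≡t

-- The walk along the word only goes downwards, so each part of a walk that stays short of a full
-- turn does so too. Together with `window-shrinkʳ` this makes windows intervals of positions.
window-shrinkˡ : (x : Fin (suc n) → Fin N) {i j k : Fin (suc n)} →
                 i Fin.≤ j → j Fin.< k → Window x i k → Window x j k
window-shrinkˡ x {i} {j} {k} i≤j j<k (inj₁ (p , _)) = inj₁ (q , run≡⇒> x j<k q)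
  where q = ℕ.≤-antisym (run-mono x (ℕ.<⇒≤ j<k)) (subst (_≤ run x j) p (run-mono x i≤j))
window-shrinkˡ x {i} {j} {k} i≤j j<k (inj₂ (p , q)) with i Fin.≟ j
... | yes refl = inj₂ (p , q)
... | no  i≢j with between (run-mono x i≤j) (run-mono x (ℕ.<⇒≤ j<k)) p
...   | inj₁ r = inj₂ (trans (cong suc r) p , ℕ.<-trans (run≡⇒> x (ℕ.≤∧≢⇒< i≤j (i≢j ∘ Fin.toℕ-injective)) (sym r)) q)
...   | inj₂ r = inj₁ (r , run≡⇒> x j<k r)

window-shrinkʳ : (x : Fin (suc n) → Fin N) {i j k : Fin (suc n)} →
                 i Fin.< j → j Fin.≤ k → Window x i k → Window x i j
window-shrinkʳ x {i} {j} {k} i<j j≤k (inj₁ (p , _)) = inj₁ (q , run≡⇒> x i<j q)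
  where q = ℕ.≤-antisym (run-mono x (ℕ.<⇒≤ i<j)) (subst (run x j ≤_) (sym p) (run-mono x j≤k))
window-shrinkʳ x {i} {j} {k} i<j j≤k (inj₂ (p , q)) with j Fin.≟ k
... | yes refl = inj₂ (p , q)
... | no  j≢k with between (run-mono x (ℕ.<⇒≤ i<j)) (run-mono x j≤k) p
...   | inj₁ r = inj₁ (sym r , run≡⇒> x i<j (sym r))
...   | inj₂ r = inj₂ (trans p (sym r) , ℕ.<-trans q (run≡⇒> x (ℕ.≤∧≢⇒< j≤k (j≢k ∘ Fin.toℕ-injective)) r))

module _ (x : Fin (suc (suc n)) → Fin N) {i k : Fin (suc n)} where

  window-suc⁻ : Window x (suc i) (suc k) → Window (x ∘ suc) i k
  window-suc⁻ with x (suc zero) <ᶠ x zero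
  ... | true  = id
  ... | false = λ { (inj₁ (p , q)) → inj₁ (ℕ.suc-injective p , q) ; (inj₂ (p , q)) → inj₂ (ℕ.suc-injective p , q) }

  window-suc⁺ : Window (x ∘ suc) i k → Window x (suc i) (suc k)
  window-suc⁺ with x (suc zero) <ᶠ x zero
  ... | true  = id
  ... | false = λ { (inj₁ (p , q)) → inj₁ (cong suc p , q) ; (inj₂ (p , q)) → inj₂ (cong suc p , q) }

window-next : (x : Fin (suc n) → Fin N) → (∀ {i j} → x i ≡ x j → i ≡ j) → (i : Fin n) → Window x (inject₁ i) (suc i)
window-next {suc n} x x-injective zero with x (suc zero) <ᶠ x zero | compare (toℕ (x (suc zero))) (toℕ (x zero))
... | _ | less p    = inj₁ (refl , p)
... | _ | notLess p = inj₂ (refl , ℕ.≤∧≢⇒< p (λ q → Fin.0≢1+n (x-injective (Fin.toℕ-injective q))))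
window-next {suc n} x x-injective (suc i) =
  window-suc⁺ x (window-next (x ∘ suc) (λ p → Fin.suc-injective (x-injective p)) i)

least : {P : Pred (Fin n) 0ℓ} → Decidable P → ∃ P → ∃ λ k → P k × (∀ {l} → P l → k Fin.≤ l)
least {suc n} P? (i , p) with P? zero
... | yes p₀ = zero , p₀ , λ _ → z≤n
least {suc n} P? (zero  , p) | no ¬p₀ = contradiction p ¬p₀
least {suc n} P? (suc i , p) | no ¬p₀ with least (P? ∘ suc) (i , p)
... | k , q , k≤ = suc k , q , λ { {zero} p₀ → contradiction p₀ ¬p₀ ; {suc l} r → s≤s (k≤ r) }

greatest : {P : Pred (Fin n) 0ℓ} → Decidable P → ∃ P → ∃ λ k → P k × (∀ {l} → P l → l Fin.≤ k)
greatest {suc n} {P} P? (i , p) with Fin.any? (P? ∘ suc)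
... | yes q with greatest (P? ∘ suc) q
...   | k , r , ≤k = suc k , r , λ { {zero} _ → z≤n ; {suc l} s → s≤s (≤k s) }
greatest {suc n} {P} P? (zero  , p) | no ¬q = zero , p , λ { {zero} _ → z≤n ; {suc l} s → contradiction (l , s) ¬q }
greatest {suc n} {P} P? (suc i , p) | no ¬q = contradiction (i , p) ¬q

-- Unit schedule numbers as a rule on windows

Undec : (Fin n → Bool) → Fin n → Set
Undec u k = u k ≡ true

-- In terms of windows, the schedule number of an undecorated letter counts the undecorated letters
-- whose windows contain it, and that of a decorated letter the undecorated letters in its own
-- window.
Unit : (Fin (suc n) → Fin N) → (Fin (suc n) → Bool) → Set
Unit x u = ∀ i →
    (u (suc i) ≡ true  → ∃! _≡_ (λ p → Undec u p × Window x p (suc i)))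
  × (u (suc i) ≡ false → ∃! _≡_ (λ k → Undec u k × Window x (suc i) k))

Rule : (Fin (suc n) → Fin N) → (Fin (suc n) → Bool) → Set
Rule x u = ∀ i → ∃! _≡_ (λ k → Undec u k × Window x (inject₁ i) k)

inject₁<fromℕ : (i : Fin n) → inject₁ i Fin.< fromℕ n
inject₁<fromℕ i = ℕ.≤-trans (s≤s (ℕ.≤-reflexive (Fin.toℕ-inject₁ i))) (ℕ.≤-trans (Fin.toℕ<n i) (ℕ.≤-reflexive (sym (Fin.toℕ-fromℕ _))))

-- For an undecorated letter the witness is the next undecorated one, `suc k`: the letter that
-- accounts for its schedule number stands no later than the given one, and windows shrink. A
-- further undecorated letter in the window would lie in the windows of both, so its schedule number
-- would exceed 1.
unit⇒rule : (x : Fin (suc n) → Fin N) (u : Fin (suc n) → Bool) → Undec u zero → Unit x u → Rule x u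
unit⇒rule {suc n} x u u₀ unit i with u (inject₁ i) in uᵢ
unit⇒rule {suc n} x u u₀ unit zero    | false = contradiction (trans (sym uᵢ) u₀) λ ()
unit⇒rule {suc n} x u u₀ unit (suc i) | false = proj₂ (unit (inject₁ i)) uᵢ
unit⇒rule {suc n} x u u₀ unit i       | true
  with least (λ k → (inject₁ i Fin.<? k) ×-dec (u k Bool.≟ true)) (fromℕ (suc n) , inject₁<fromℕ i , uₙ)
  where
  -- If the last letter were decorated, its window would have to contain a later letter.
  uₙ : u (fromℕ (suc n)) ≡ true
  uₙ with u (fromℕ (suc n)) in q
  ... | true  = refl
  ... | false with proj₂ (unit (fromℕ n)) q
  ...   | k , (_ , w) , _ = contradiction (Fin.≤fromℕ k) (ℕ.<⇒≱ (window⇒< x w))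
... | suc k , (i<k , uₖ) , k≤ with proj₁ (unit k) uₖ
...   | p , (uₚ , w) , _ = suc k , (uₖ , window-shrinkˡ x p≤i i<k w) , λ {l} → unique l
  where
  p≤i : p Fin.≤ inject₁ i
  p≤i = ℕ.≮⇒≥ (λ i<p → ℕ.<⇒≱ (window⇒< x w) (k≤ (i<p , uₚ)))
  unique : ∀ l → Undec u l × Window x (inject₁ i) l → suc k ≡ l
  unique (suc l) (uₗ , v) with suc k Fin.≟ suc l
  ... | yes k≡l = k≡l
  ... | no  k≢l with proj₁ (unit l) uₗ
  ...   | q , _ , q≡ = contradiction (trans (sym (q≡ (uᵢ , v))) (q≡ (uₖ , window-shrinkˡ x (ℕ.<⇒≤ i<k) k<l v)))
                         (λ i≡k → ℕ.<-irrefl (cong toℕ i≡k) i<k)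
    where
    k<l : suc k Fin.< suc l
    k<l = ℕ.≤∧≢⇒< (k≤ (window⇒< x v , uₗ)) (k≢l ∘ Fin.toℕ-injective)
  unique zero (_ , v) = contradiction (window⇒< x v) λ ()

-- For an undecorated letter the witness is the last undecorated one before it, which exists because
-- position 0 is undecorated. An earlier witness would have two undecorated letters in its window.
rule⇒unit : (x : Fin (suc n) → Fin N) (u : Fin (suc n) → Bool) → Undec u zero → Rule x u → Unit x u
rule⇒unit {suc n} x u u₀ rule i = undecorated , decorated
  where
  ruleAt : ∀ {j k : Fin (suc (suc n))} → j Fin.< k → ∃! _≡_ (λ k → Undec u k × Window x j k)
  ruleAt {j} {k} j<k with view j
  ... | ‵fromℕ     = contradiction (Fin.≤fromℕ k) (ℕ.<⇒≱ j<k)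
  ... | ‵inject₁ j = rule j

  undecorated : u (suc i) ≡ true → ∃! _≡_ (λ p → Undec u p × Window x p (suc i))
  undecorated uᵢ with greatest (λ p → (p Fin.<? suc i) ×-dec (u p Bool.≟ true)) (zero , s≤s z≤n , u₀)
  ... | p , (p<i , uₚ) , ≤p with ruleAt p<i
  ...   | k , (uₖ , w) , _ = p , (uₚ , window-shrinkʳ x p<i i≤k w) , λ {q} → unique q
    where
    i≤k : suc i Fin.≤ k
    i≤k = ℕ.≮⇒≥ (λ k<i → ℕ.<⇒≱ (window⇒< x w) (≤p (k<i , uₖ)))
    unique : ∀ q → Undec u q × Window x q (suc i) → p ≡ q
    unique q (u′ , v) with p Fin.≟ q
    ... | yes p≡q = p≡q
    ... | no  p≢q with ruleAt (window⇒< x v)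
    ...   | l , _ , l≡ = contradiction
      (trans (sym (l≡ (uₚ , window-shrinkʳ x q<p (ℕ.<⇒≤ p<i) v))) (l≡ (uᵢ , v)))
      (λ p≡i → ℕ.<-irrefl (cong toℕ p≡i) p<i)
      where
      q<p : q Fin.< p
      q<p = ℕ.≤∧≢⇒< (≤p (window⇒< x v , u′)) (λ r → p≢q (sym (Fin.toℕ-injective r)))

  decorated : ∀ {j} → u j ≡ false → ∃! _≡_ (λ k → Undec u k × Window x j k)
  decorated {j} uⱼ with view j
  ... | ‵inject₁ j = rule j
  -- The rule at the last position but one has only the last position to choose, so the last letter
  -- is undecorated.
  ... | ‵fromℕ with rule (fromℕ n)
  ...   | k , (uₖ , w) , _ = contradiction (trans (sym uⱼ) (trans (cong u (sym k≡n)) uₖ)) λ ()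
    where
    k≡n : k ≡ suc (fromℕ n)
    k≡n = Fin.toℕ-injective (ℕ.≤-antisym (Fin.≤fromℕ k)
            (subst (λ l → suc l ≤ toℕ k) (Fin.toℕ-inject₁ (fromℕ n)) (window⇒< x w)))

rule-tail : (x : Fin (suc (suc n)) → Fin N) (u : Fin (suc (suc n)) → Bool) → Rule x u → Rule (x ∘ suc) (u ∘ suc)
rule-tail x u rule i with rule (suc i)
... | zero  , (_ , w) , _ = contradiction (window⇒< x w) λ ()
... | suc k , (uₖ , w) , k≡ = k , (uₖ , window-suc⁻ x w) , λ (uₗ , v) → Fin.suc-injective (k≡ (uₗ , window-suc⁺ x v))

-- Position 1 always lies in the window of position 0. It is thus undecorated only if no later
-- undecorated letter lies there, and this depends on the later decorations alone.
first-undecorated : (x : Fin (suc (suc n)) → Fin N) → (∀ {i j} → x i ≡ x j → i ≡ j) →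
  (u u′ : Fin (suc (suc n)) → Bool) → Rule x u → Rule x u′ →
  (∀ i → u (suc (suc i)) ≡ u′ (suc (suc i))) → Undec u (suc zero) → Undec u′ (suc zero)
first-undecorated x x-injective u u′ rule rule′ later u₁ with rule zero | rule′ zero
... | _ , _ , k≡ | zero        , (_ , w) , _   = contradiction (window⇒< x w) λ ()
... | _ , _ , k≡ | suc zero    , (u₁′ , _) , _ = u₁′
... | _ , _ , k≡ | suc (suc l) , (uₗ , w) , _  =
  contradiction (trans (sym (k≡ (u₁ , window-next x x-injective zero))) (k≡ (trans (later l) uₗ , w))) λ ()

rule-unique : (x : Fin (suc n) → Fin N) → (∀ {i j} → x i ≡ x j → i ≡ j) →
              (u u′ : Fin (suc n) → Bool) → Rule x u → Rule x u′ → ∀ i → u (suc i) ≡ u′ (suc i)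
rule-unique {zero}  x x-injective u u′ rule rule′ ()
rule-unique {suc n} x x-injective u u′ rule rule′ = agree
  where
  later : ∀ i → u (suc (suc i)) ≡ u′ (suc (suc i))
  later = rule-unique (x ∘ suc) (λ p → Fin.suc-injective (x-injective p)) (u ∘ suc) (u′ ∘ suc)
                  (rule-tail x u rule) (rule-tail x u′ rule′)
  agree : ∀ i → u (suc i) ≡ u′ (suc i)
  agree (suc i) = later i
  agree zero with u (suc zero) in p | u′ (suc zero) in p′
  ... | true  | true  = refl
  ... | false | false = refl
  ... | true  | false = contradiction (trans (sym p′)
    (first-undecorated x x-injective u u′ rule rule′ later p)) λ ()
  ... | false | true  = contradiction (trans (sym p)
    (first-undecorated x x-injective u′ u rule′ rule (sym ∘ later) p′)) λ ()

-- The decoration of a circular word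

-- The gap is filled with a letter, which is put in front of the word. For the gap `zero` this is
-- the usual prefix 0.
around : Fin (suc n) → Permutation′ n → Fin (suc n) → Fin (suc n)
around a τ zero    = a
around a τ (suc i) = punchIn a (τ ⟨$⟩ʳ i)

around-suc : (a : Fin (suc (suc n))) (τ : Permutation′ (suc n)) (i : Fin (suc n)) →
             around a τ (suc i) ≡ punchIn a (around (τ ⟨$⟩ʳ zero) (delete zero τ) i)
around-suc a τ zero    = refl
around-suc a τ (suc i) = cong (punchIn a) (permute-punchIn zero τ i)

around-injective : (a : Fin (suc n)) (τ : Permutation′ n) {i j : Fin (suc n)} → around a τ i ≡ around a τ j → i ≡ j
around-injective a τ {zero}  {zero}  p = refl
around-injective a τ {zero}  {suc j} p = contradiction (sym p) (Fin.punchInᵢ≢i a (τ ⟨$⟩ʳ j))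
around-injective a τ {suc i} {zero}  p = contradiction p (Fin.punchInᵢ≢i a (τ ⟨$⟩ʳ i))
around-injective a τ {suc i} {suc j} p = cong suc (permute-injective τ (Fin.punchIn-injective a _ _ p))

<-transport : ∀ {k l} {i : Fin k} {j : Fin l} {i′ : Fin m} {j′ : Fin n} →
              (i <ᶠ j) ≡ (i′ <ᶠ j′) → i Fin.< j → i′ Fin.< j′
<-transport p i<j = <ᶠ⇒< (trans (sym p) (<⇒<ᵇ≡true i<j))

run-invariant : ∀ {k l} (x : Fin (suc n) → Fin k) (y : Fin (suc n) → Fin l) →
                (∀ i j → (x i <ᶠ x j) ≡ (y i <ᶠ y j)) → ∀ i → run x i ≡ run y i
run-invariant         x y p zero    = refl
run-invariant {suc n} x y p (suc i) = cong₂ advance (p (suc zero) zero)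
  (run-invariant (x ∘ suc) (y ∘ suc) (λ i j → p (suc i) (suc j)) i)

window-invariant : ∀ {k l} (x : Fin (suc n) → Fin k) (y : Fin (suc n) → Fin l) →
                   (∀ i j → (x i <ᶠ x j) ≡ (y i <ᶠ y j)) → ∀ {i j} → Window x i j → Window y i j
window-invariant x y p {i} {j} (inj₁ (q , r)) = inj₁
  (trans (sym (run-invariant x y p i)) (trans q (run-invariant x y p j)) , <-transport (p j i) r)
window-invariant x y p {i} {j} (inj₂ (q , r)) = inj₂
  (trans (cong suc (sym (run-invariant x y p i))) (trans q (run-invariant x y p j)) , <-transport (p i j) r)

module _ (a : Fin (suc (suc n))) (τ : Permutation′ (suc n)) where

  private
    x = around a τ
    y = around (τ ⟨$⟩ʳ zero) (delete zero τ)

  around-<ᶠ : ∀ i j → (x (suc i) <ᶠ x (suc j)) ≡ (y i <ᶠ y j)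
  around-<ᶠ i j = trans (cong₂ _<ᶠ_ (around-suc a τ i) (around-suc a τ j)) (punchIn-<ᶠ a (y i) (y j))

  window-around⁻ : ∀ {i j} → Window x (suc i) (suc j) → Window y i j
  window-around⁻ = window-invariant (x ∘ suc) y around-<ᶠ ∘ window-suc⁻ x

  window-around⁺ : ∀ {i j} → Window y i j → Window x (suc i) (suc j)
  window-around⁺ = window-suc⁺ x ∘ window-invariant y (x ∘ suc) (λ i j → sym (around-<ᶠ i j))

-- With W standing for Window x zero k, where x₀, x₁, xₖ are letters of x and
-- k lies in the window of position 1.

data Turn (x₀ x₁ xₖ : ℕ) (W : Set) : Set where
  within  : x₁ < x₀ → xₖ < x₁ → W → Turn x₀ x₁ xₖ W
  overDescent   : x₁ < x₀ → x₁ < xₖ → (x₀ < xₖ → W) → (W → x₀ < xₖ) → Turn x₀ x₁ xₖ W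
  overAscent   : x₀ < x₁ → xₖ < x₁ → (x₀ < xₖ → W) → (W → x₀ < xₖ) → Turn x₀ x₁ xₖ W
  without : x₀ < x₁ → x₁ < xₖ → ¬ W → Turn x₀ x₁ xₖ W

-- An ascent from position 0 to position 1 and a change of run between position 1 and `k` each pass
-- the top of the circle. If neither occurs, the walk from position 0 stays short of a full turn; if
-- both occur, it does not; if one occurs, the letters at 0 and `k` decide.
turn : (x : Fin (suc (suc n)) → Fin N) {k : Fin (suc (suc n))} → x zero ≢ x (suc zero) → Window x (suc zero) k →
       Turn (toℕ (x zero)) (toℕ (x (suc zero))) (toℕ (x k)) (Window x zero k)
turn x {k} x₀≢x₁ w with run x k | x (suc zero) <ᶠ x zero | compare (toℕ (x (suc zero))) (toℕ (x zero)) | w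
... | r | _ | less p    | inj₁ (q , xₖ<x₁) = within p xₖ<x₁ (inj₁ (q , ℕ.<-trans xₖ<x₁ p))
... | r | _ | less p    | inj₂ (q , x₁<xₖ) = overDescent p x₁<xₖ (λ x₀<xₖ → inj₂ (q , x₀<xₖ))
  λ { (inj₁ (q′ , _)) → contradiction (trans q′ (sym q)) λ () ; (inj₂ (_ , x₀<xₖ)) → x₀<xₖ }
... | r | _ | notLess p | inj₁ (q , xₖ<x₁) = overAscent (ℕ.≤∧≢⇒< p (x₀≢x₁ ∘ Fin.toℕ-injective)) xₖ<x₁ (λ x₀<xₖ → inj₂ (q , x₀<xₖ))
  λ { (inj₁ (q′ , _)) → contradiction (trans q′ (sym q)) λ () ; (inj₂ (_ , x₀<xₖ)) → x₀<xₖ }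
... | r | _ | notLess p | inj₂ (q , x₁<xₖ) = without (ℕ.≤∧≢⇒< p (x₀≢x₁ ∘ Fin.toℕ-injective)) x₁<xₖ
  λ { (inj₁ (q′ , _)) → contradiction (trans q′ (sym q)) λ () ; (inj₂ (q′ , _)) → contradiction (trans q′ (sym q)) λ () }

-- The number s of letters met when going upwards from the gap t to the letter
-- w, which is included, in a circle of m letters.

data Distance (m t w s : ℕ) : Set where
  ahead  : t ≤ w → s + t ≡ suc w → Distance m t w s
  behind : w < t → s + t ≡ m + suc w → Distance m t w s

distance-start : ∀ {m a t e s} → Arc m a t e → s + e ≡ suc m → Distance (suc m) a t s
distance-start {m} {a} {t} {e} {s} (direct t<a p) q = behind t<a (begin
  s + a             ≡⟨ cong (s +_) p ⟨
  s + (e + suc t)   ≡⟨ ℕ.+-assoc s e (suc t) ⟨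
  s + e + suc t     ≡⟨ cong (_+ suc t) q ⟩
  suc m + suc t     ∎)
  where open ≡-Reasoning
distance-start {m} {a} {t} {e} {s} (wrapped a≤t p) q = ahead a≤t (ℕ.+-cancelˡ-≡ m _ _ (begin
  m + (s + a)   ≡⟨ regroup m s a ⟩
  s + (m + a)   ≡⟨ cong (s +_) p ⟨
  s + (e + t)   ≡⟨ ℕ.+-assoc s e t ⟨
  s + e + t     ≡⟨ cong (_+ t) q ⟩
  suc m + t     ≡⟨ ℕ.+-suc m t ⟨
  m + suc t     ∎))
  where
  open ≡-Reasoning
  regroup : ∀ m s a → m + (s + a) ≡ s + (m + a)
  regroup = solve-∀

punchIn-< : (v : Fin (suc n)) (x : Fin n) → x Fin.< v → toℕ (punchIn v x) ≡ toℕ x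
punchIn-< (suc v) zero    _         = refl
punchIn-< (suc v) (suc x) (s≤s x<v) = cong suc (punchIn-< v x x<v)

punchIn-≥ : (v : Fin (suc n)) (x : Fin n) → v Fin.≤ x → toℕ (punchIn v x) ≡ suc (toℕ x)
punchIn-≥ zero    x       _         = refl
punchIn-≥ (suc v) (suc x) (s≤s v≤x) = cong suc (punchIn-≥ v x v≤x)

module _ {m a e r : ℕ} {t : Fin (suc m)} {v : Fin m} where

  private
    t′ v′ w : ℕ
    t′ = toℕ t
    v′ = toℕ v
    w  = toℕ (punchIn t v)

    regroup₁ : ∀ s e t → s + (e + suc t) ≡ suc (s + e + t)
    regroup₁ = solve-∀

    regroup₂ : ∀ m s a → m + (s + a) ≡ s + (m + a)
    regroup₂ = solve-∀

    Step : Set → Set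
    Step W = (e < r × W × (∀ {s} → s + e ≡ r → Distance (suc m) a w s)) ⊎ (r ≤ e × ¬ W)

  -- Going upwards from `t` one meets the gap `a` after `e` letters and the undecorated letter as
  -- the `r`-th. So `e < r` means that the walk from `a` down through `t` to that letter ends before
  -- it returns to `a`. Here `w` is this letter numbered with `t` present, and the hypotheses on `W`
  -- are the cases of `Turn`.
  distance-step : ∀ {W : Set} → a ≤ suc m → Arc m a t′ e → Distance m t′ v′ r →
                  (t′ < a → v′ < t′ → W) → (¬ (a ≤ t′ × t′ ≤ v′) → a ≤ w → W) → (W → (t′ < a × v′ < t′) ⊎ a ≤ w) →
                  (a ≤ t′ → t′ ≤ v′ → ¬ W) → Step W
  distance-step a≤1+m (direct t<a p) (behind v<t q) W₁ W₂ W⁻ ¬W = inj₁ (e<r , W₁ t<a v<t , λ {s} h → behind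
      (ℕ.≤-trans (s≤s (ℕ.≤-reflexive w≡v)) (ℕ.<-trans v<t t<a)) (begin
        s + a                ≡⟨ cong (s +_) p ⟨
        s + (e + suc t′)     ≡⟨ regroup₁ s e t′ ⟩
        suc (s + e + t′)     ≡⟨ cong (λ k → suc (k + t′)) h ⟩
        suc (r + t′)         ≡⟨ cong suc q ⟩
        suc (m + suc v′)     ≡⟨ cong (λ k → suc (m + suc k)) w≡v ⟨
        suc m + suc w        ∎))
    where
    open ≡-Reasoning
    w≡v : w ≡ v′
    w≡v = punchIn-< t v v<t
    e<r : e < r
    e<r = ℕ.+-cancelʳ-< t′ e r (ℕ.≤-trans (ℕ.≤-trans (ℕ.≤-reflexive (trans (sym (ℕ.+-suc e t′)) p)) a≤1+m)
            (ℕ.≤-trans (s≤s (ℕ.m≤m+n m v′)) (ℕ.≤-reflexive (trans (sym (ℕ.+-suc m v′)) (sym q)))))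
  distance-step a≤1+m (direct t<a p) (ahead t≤v q) W₁ W₂ W⁻ ¬W with a ℕ.≤? w
  ... | yes a≤w = inj₁ (e<r , W₂ (ℕ.<⇒≱ t<a ∘ proj₁) a≤w , λ {s} h → ahead a≤w (begin
        s + a                ≡⟨ cong (s +_) p ⟨
        s + (e + suc t′)     ≡⟨ regroup₁ s e t′ ⟩
        suc (s + e + t′)     ≡⟨ cong (λ k → suc (k + t′)) h ⟩
        suc (r + t′)         ≡⟨ cong suc q ⟩
        suc (suc v′)         ≡⟨ cong suc w≡1+v ⟨
        suc w                ∎))
    where
    open ≡-Reasoning
    w≡1+v : w ≡ suc v′
    w≡1+v = punchIn-≥ t v t≤v
    e<r : e < r
    e<r = ℕ.+-cancelʳ-< t′ e r (ℕ.≤-trans (ℕ.≤-reflexive (trans (sym (ℕ.+-suc e t′)) p))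
            (ℕ.≤-trans a≤w (ℕ.≤-reflexive (trans w≡1+v (sym q)))))
  ... | no a≰w = inj₂ (r≤e , λ W → case W⁻ W of λ
          { (inj₁ (_ , v<t)) → ℕ.<⇒≱ v<t t≤v ; (inj₂ a≤w) → a≰w a≤w })
    where
    r≤e : r ≤ e
    r≤e = ℕ.+-cancelʳ-≤ t′ r e (ℕ.s≤s⁻¹ (ℕ.≤-trans
            (s≤s (ℕ.≤-reflexive (trans q (sym (punchIn-≥ t v t≤v)))))
            (ℕ.≤-trans (ℕ.≰⇒> a≰w) (ℕ.≤-reflexive (trans (sym p) (ℕ.+-suc e t′))))))
  distance-step a≤1+m (wrapped a≤t p) (behind v<t q) W₁ W₂ W⁻ ¬W with a ℕ.≤? w
  ... | yes a≤w = inj₁ (e<r , W₂ (ℕ.<⇒≱ v<t ∘ proj₂) a≤w , λ {s} h → ahead a≤w (ℕ.+-cancelˡ-≡ m _ _ (begin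
        m + (s + a)          ≡⟨ regroup₂ m s a ⟩
        s + (m + a)          ≡⟨ cong (s +_) p ⟨
        s + (e + t′)         ≡⟨ ℕ.+-assoc s e t′ ⟨
        s + e + t′           ≡⟨ cong (_+ t′) h ⟩
        r + t′               ≡⟨ q ⟩
        m + suc v′           ≡⟨ cong (λ k → m + suc k) w≡v ⟨
        m + suc w            ∎)))
    where
    open ≡-Reasoning
    w≡v : w ≡ v′
    w≡v = punchIn-< t v v<t
    e<r : e < r
    e<r = ℕ.+-cancelʳ-< t′ e r (ℕ.≤-trans (s≤s (ℕ.≤-trans (ℕ.≤-reflexive p) (ℕ.+-monoʳ-≤ m (ℕ.≤-trans a≤w (ℕ.≤-reflexive w≡v)))))
            (ℕ.≤-reflexive (trans (sym (ℕ.+-suc m v′)) (sym q))))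
  ... | no a≰w = inj₂ (r≤e , λ W → case W⁻ W of λ
          { (inj₁ (t<a , _)) → ℕ.<⇒≱ t<a a≤t ; (inj₂ a≤w) → a≰w a≤w })
    where
    r≤e : r ≤ e
    r≤e = ℕ.+-cancelʳ-≤ t′ r e (ℕ.≤-trans (ℕ.≤-reflexive q)
            (ℕ.≤-trans (ℕ.+-monoʳ-≤ m (subst (_< a) (punchIn-< t v v<t) (ℕ.≰⇒> a≰w))) (ℕ.≤-reflexive (sym p))))
  distance-step a≤1+m (wrapped a≤t p) (ahead t≤v q) W₁ W₂ W⁻ ¬W =
    inj₂ (ℕ.+-cancelʳ-≤ t′ r e (ℕ.≤-trans (ℕ.≤-reflexive q) (ℕ.≤-trans (Fin.toℕ<n v)
           (ℕ.≤-trans (ℕ.m≤m+n m a) (ℕ.≤-reflexive (sym p))))) , ¬W a≤t t≤v)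

reach-short : (e : Fin (suc n)) (c : Code n) → toℕ e < reach c → reach (e ∷ c) + toℕ e ≡ reach c
reach-short {n} e c e<r = elim (reachStep e c)
  where
  elim : ∀ {s d b} → ReachStep n (toℕ e) (reach c) (ascending c) s d b → s + toℕ e ≡ reach c
  elim (short _ p)  = p
  elim (long r≤e _) = contradiction e<r (ℕ.≤⇒≯ r≤e)

reach-long : (e : Fin (suc n)) (c : Code n) → reach c ≤ toℕ e → reach (e ∷ c) + toℕ e ≡ suc n
reach-long {n} e c r≤e = elim (reachStep e c)
  where
  elim : ∀ {s d b} → ReachStep n (toℕ e) (reach c) (ascending c) s d b → s + toℕ e ≡ suc n
  elim (long _ p)    = p
  elim (short e<r _) = contradiction e<r (ℕ.≤⇒≯ r≤e)

-- `distance` is the invariant that drives the induction: through it, comparing the next entry of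
-- the code with the reach decides whether this letter stays in the window.
record FirstUndecorated (a : Fin (suc (suc n))) (τ : Permutation′ (suc n)) : Set where
  field
    index       : Fin (suc n)
    undecorated : decorations (cyclicCode a τ) index ≡ false
    window      : Window (around a τ) zero (suc index)
    unique      : ∀ l → decorations (cyclicCode a τ) l ≡ false → Window (around a τ) zero (suc l) → index ≡ l
    distance    : Distance (suc n) (toℕ a) (toℕ (τ ⟨$⟩ʳ index)) (reach (cyclicCode a τ))

module _ (a : Fin (suc (suc n))) (τ : Permutation′ (suc n)) where

  private
    e = arcLength a (τ ⟨$⟩ʳ zero)
    c = cyclicCode (τ ⟨$⟩ʳ zero) (delete zero τ)
    x = around a τ

  first-long : reach c ≤ toℕ e → (∀ l → decorations c l ≡ false → ¬ Window x zero (suc (suc l))) → FirstUndecorated a τ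
  first-long r≤e none = record
    { index       = zero
    ; undecorated = ≤⇒<ᵇ≡false r≤e
    ; window      = window-next x (around-injective a τ) zero
    ; unique      = λ { zero _ _ → refl ; (suc l) d w → contradiction w (none l d) }
    ; distance    = distance-start (proj₂ (arc a (τ ⟨$⟩ʳ zero))) (reach-long {n} e c r≤e)
    }

module _ (a : Fin (suc (suc (suc n)))) (τ : Permutation′ (suc (suc n)))
         (first : FirstUndecorated (τ ⟨$⟩ʳ zero) (delete zero τ)) where

  private
    open FirstUndecorated first

    x : Fin (suc (suc (suc n))) → Fin (suc (suc (suc n)))
    x = around a τ

    t : Fin (suc (suc n))
    t = τ ⟨$⟩ʳ zero

    v : Fin (suc n)
    v = delete zero τ ⟨$⟩ʳ index

    k : Fin (suc (suc (suc n)))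
    k = suc (suc index)

    e = arcLength a t
    c = cyclicCode t (delete zero τ)

    W : Set
    W = Window x zero k

    xₖ≡ : x k ≡ punchIn a (punchIn t v)
    xₖ≡ = around-suc a τ (suc index)

    k<1 : x k Fin.< x (suc zero) → v Fin.< t
    k<1 = <-transport (trans (cong (_<ᶠ x (suc zero)) xₖ≡) (trans (punchIn-<ᶠ a (punchIn t v) t) (punchIn<ᶠhole t v)))

    1<k : x (suc zero) Fin.< x k → t Fin.≤ v
    1<k q = ℕ.s≤s⁻¹ (<-transport {j′ = suc v}
      (trans (cong (x (suc zero) <ᶠ_) xₖ≡) (trans (punchIn-<ᶠ a t (punchIn t v)) (hole<ᶠpunchIn t v))) q)

    1<0 : x (suc zero) Fin.< a → t Fin.< a
    1<0 = <-transport (punchIn<ᶠhole a t)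

    0<1 : a Fin.< x (suc zero) → a Fin.≤ t
    0<1 q = ℕ.s≤s⁻¹ (<-transport {i = a} {j = x (suc zero)} {i′ = a} {j′ = suc t} (hole<ᶠpunchIn a t) q)

    0<k≡ : (a <ᶠ x k) ≡ (a <ᶠ suc (punchIn t v))
    0<k≡ = trans (cong (a <ᶠ_) xₖ≡) (hole<ᶠpunchIn a (punchIn t v))

    0<k⁻ : a Fin.< x k → a Fin.≤ punchIn t v
    0<k⁻ q = ℕ.s≤s⁻¹ (<-transport {j′ = suc (punchIn t v)} 0<k≡ q)

    0<k⁺ : a Fin.≤ punchIn t v → a Fin.< x k
    0<k⁺ q = <-transport {i = a} {j = suc (punchIn t v)} (sym 0<k≡) (s≤s q)

    turned : Turn (toℕ a) (toℕ (x (suc zero))) (toℕ (x k)) W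
    turned = turn x (λ q → Fin.0≢1+n (around-injective a τ {zero} {suc zero} q)) (window-around⁺ a τ window)

    within′ : t Fin.< a → v Fin.< t → W
    within′ t<a v<t with turned
    ... | within _ _ w    = w
    ... | overDescent _ p _ _   = contradiction v<t (ℕ.≤⇒≯ (1<k p))
    ... | overAscent p _ _ _   = contradiction t<a (ℕ.≤⇒≯ (0<1 p))
    ... | without p _ _   = contradiction t<a (ℕ.≤⇒≯ (0<1 p))

    over⁺ : ¬ (a Fin.≤ t × t Fin.≤ v) → a Fin.≤ punchIn t v → W
    over⁺ ¬wo a≤w with turned
    ... | within _ _ w    = w
    ... | overDescent _ _ f _   = f (0<k⁺ a≤w)
    ... | overAscent _ _ f _   = f (0<k⁺ a≤w)
    ... | without p q _   = contradiction (0<1 p , 1<k q) ¬wo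

    over⁻ : W → (t Fin.< a × v Fin.< t) ⊎ a Fin.≤ punchIn t v
    over⁻ w with turned
    ... | within p q _    = inj₁ (1<0 p , k<1 q)
    ... | overDescent _ _ _ g   = inj₂ (0<k⁻ (g w))
    ... | overAscent _ _ _ g   = inj₂ (0<k⁻ (g w))
    ... | without _ _ ¬w  = contradiction w ¬w

    without′ : a Fin.≤ t → t Fin.≤ v → ¬ W
    without′ a≤t t≤v with turned
    ... | within p _ _    = contradiction (1<0 p) (ℕ.≤⇒≯ a≤t)
    ... | overDescent p _ _ _   = contradiction (1<0 p) (ℕ.≤⇒≯ a≤t)
    ... | overAscent _ q _ _   = contradiction (k<1 q) (ℕ.≤⇒≯ t≤v)
    ... | without _ _ ¬w  = ¬w

    -- A window of position 0 that extends beyond position 1 shrinks to a window of position 1,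
    -- where the shorter word has just one undecorated letter.
    only : ∀ l → decorations c l ≡ false → Window x zero (suc (suc l)) → index ≡ l
    only l d w = unique l d (window-around⁻ a τ (window-shrinkˡ x z≤n (s≤s (s≤s z≤n)) w))

  first-step : FirstUndecorated a τ
  first-step with distance-step {t = t} {v = v} (Fin.toℕ≤pred[n] a) (proj₂ (arc a t)) distance within′ over⁺ over⁻ without′
  ... | inj₁ (e<r , w , far) = record
    { index       = suc index
    ; undecorated = undecorated
    ; window      = w
    ; unique      = λ { zero d _    → contradiction (trans (sym (<⇒<ᵇ≡true e<r)) d) λ ()
                      ; (suc l) d v → cong suc (only l d v) }
    ; distance    = subst (λ i → Distance (suc (suc n)) (toℕ a) (toℕ i) (reach (e ∷ c))) (sym (permute-punchIn zero τ index)) (far (reach-short e c e<r))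
    }
  ... | inj₂ (r≤e , ¬w) = first-long a τ r≤e λ l d v →
    ¬w (subst (λ i → Window x zero (suc (suc i))) (sym (only l d v)) v)

first-undecorated-exists : (a : Fin (suc (suc n))) (τ : Permutation′ (suc n)) → FirstUndecorated a τ
-- The entry of a lone letter is compared with the reach 0 of the empty code, so this letter is
-- undecorated.
first-undecorated-exists {zero}  a τ = first-long a τ z≤n λ ()
first-undecorated-exists {suc n} a τ = first-step a τ (first-undecorated-exists (τ ⟨$⟩ʳ zero) (delete zero τ))

undecoratedPositions : Code n → Fin (suc n) → Bool
undecoratedPositions c zero    = true
undecoratedPositions c (suc i) = not (decorations c i)

code-rule : (a : Fin (suc n)) (τ : Permutation′ n) → Rule (around a τ) (undecoratedPositions (cyclicCode a τ))
code-rule {suc n} a τ zero = suc index , (cong not undecorated , window) , λ {l} → only l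
  where
  open FirstUndecorated (first-undecorated-exists a τ)
  only : ∀ l → Undec (undecoratedPositions (cyclicCode a τ)) l × Window (around a τ) zero l → suc index ≡ l
  only zero    (_ , w) = contradiction (window⇒< (around a τ) {zero} {zero} w) λ ()
  only (suc l) (u , w) = cong suc (unique l (not-injective {y = false} u) w)
code-rule {suc n} a τ (suc i) with code-rule (τ ⟨$⟩ʳ zero) (delete zero τ) i
... | k , (uₖ , w) , k≡ = suc k , (later k uₖ (window⇒< y w) , window-around⁺ a τ w) , λ {l} → only l
  where
  y = around (τ ⟨$⟩ʳ zero) (delete zero τ)
  c = cyclicCode (τ ⟨$⟩ʳ zero) (delete zero τ)
  u = undecoratedPositions (cyclicCode a τ)
  -- Position 0 of the shorter word is undecorated by convention, whatever the code says of it in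
  -- the longer word; positions after `inject₁ i` avoid this clash.
  later : ∀ l → Undec (undecoratedPositions c) l → inject₁ i Fin.< l → Undec u (suc l)
  later (suc l) q _ = q
  only : ∀ l → Undec u l × Window (around a τ) (suc (inject₁ i)) l → suc k ≡ l
  only zero          (_ , v) = contradiction (window⇒< (around a τ) {suc (inject₁ i)} {zero} v) λ ()
  only (suc zero)    (_ , v) = contradiction (window⇒< (around a τ) {suc (inject₁ i)} {suc zero} v) λ { (s≤s ()) }
  only (suc (suc l)) (q , v) = cong suc (k≡ (q , window-around⁻ a τ v))

-- Schedule numbers as sizes of windows

-- `addToRuns` compares a new letter with the head of the first run. Knowing this head to be the
-- next letter of the word turns its test into the one in `run`.
runs-head : (x : Fin (suc n) → Fin N) → ∃₂ λ r rs → runs (tabulate x) ≡ (x zero ∷ r) ∷ rs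
runs-head {zero}  x = _ , _ , refl
runs-head {suc n} x with runs (tabulate (x ∘ suc)) | runs-head (x ∘ suc)
... | _ | r , rs , refl with x (suc zero) <ᶠ x zero
...   | true  = _ , _ , refl
...   | false = _ , _ , refl

count-∷ : {P : Pred A 0ℓ} (P? : Decidable P) (a : A) (as : List A) →
          count P? (a ∷ as) ≡ indicator (does (P? a)) + count P? as
count-∷ P? a as with does (P? a)
... | true  = refl
... | false = refl

count-run : {P : Pred (Fin N) 0ℓ} (P? : Decidable P) (x : Fin (suc n) → Fin N) (j : ℕ) →
  count P? (nthRun (runs (tabulate x)) j) ≡ ∑ (λ i → indicator ((run x i ≡ᵇ j) ∧ does (P? (x i))))
count-run {n = zero}  P? x zero    = count-∷ P? (x zero) []
count-run {n = zero}  P? x (suc j) = refl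
count-run {n = suc n} P? x j
  with runs (tabulate (x ∘ suc)) | runs-head (x ∘ suc) | count-run P? (x ∘ suc)
... | _ | r , rs , refl | tail with x (suc zero) <ᶠ x zero
count-run {n = suc n} P? x zero    | _ | r , rs , refl | tail | true =
  trans (count-∷ P? (x zero) (x (suc zero) ∷ r)) (cong (indicator (does (P? (x zero))) +_) (tail zero))
count-run {n = suc n} P? x (suc j) | _ | r , rs , refl | tail | true = tail (suc j)
count-run {n = suc n} P? x zero    | _ | r , rs , refl | tail | false =
  trans (count-∷ P? (x zero) []) (cong (indicator (does (P? (x zero))) +_) (sym (∑-zero {suc n} _ (λ _ → refl))))
count-run {n = suc n} P? x (suc j) | _ | r , rs , refl | tail | false = tail j

runIndex-run : (x : Fin (suc n) → Fin N) → (∀ {i j} → x i ≡ x j → i ≡ j) →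
               (i : Fin (suc n)) → runIndex (x i) (runs (tabulate x)) ≡ run x i
runIndex-run x x-injective zero
  with runs (tabulate x) | runs-head x
... | _ | r , rs , refl rewrite dec-true (x zero Fin.≟ x zero) refl = refl
runIndex-run {suc n} x x-injective (suc i)
  with runs (tabulate (x ∘ suc)) | runs-head (x ∘ suc) | runIndex-run (x ∘ suc) (λ p → Fin.suc-injective (x-injective p)) i
... | _ | r , rs , refl | tail with x (suc zero) <ᶠ x zero
...   | true  rewrite dec-false (x (suc i) Fin.≟ x zero) (λ p → Fin.0≢1+n (sym (x-injective p))) = tail
...   | false rewrite dec-false (x (suc i) Fin.≟ x zero) (λ p → Fin.0≢1+n (sym (x-injective p))) = cong suc tail

∑-indicator⁻ : (b : Fin n → Bool) → ∑ (indicator ∘ b) ≡ 0 → ∀ i → b i ≡ false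
∑-indicator⁻ b p zero with b zero
... | false = refl
∑-indicator⁻ b p (suc i) with b zero
... | false = ∑-indicator⁻ (b ∘ suc) p i

∑≡1⇒∃! : (b : Fin n → Bool) → ∑ (indicator ∘ b) ≡ 1 → ∃! _≡_ (λ i → b i ≡ true)
∑≡1⇒∃! {suc n} b p with b zero in q
... | true  = zero , q , λ { {zero} _  → refl
                           ; {suc i} r → contradiction (trans (sym r) (∑-indicator⁻ (b ∘ suc) (ℕ.suc-injective p) i)) λ () }
... | false with ∑≡1⇒∃! (b ∘ suc) p
...   | i , r , i≡ = suc i , r , λ { {zero} s  → contradiction (trans (sym s) q) λ ()
                                   ; {suc j} s → cong suc (i≡ s) }

∃!⇒∑≡1 : (b : Fin n → Bool) → ∃! _≡_ (λ i → b i ≡ true) → ∑ (indicator ∘ b) ≡ 1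
∃!⇒∑≡1 {suc n} b (zero , r , i≡) rewrite r = cong suc (∑-zero {n} _ λ i → none i)
  where
  none : ∀ i → indicator (b (suc i)) ≡ 0
  none i with b (suc i) in s
  ... | false = refl
  ... | true  = contradiction (i≡ s) λ ()
∃!⇒∑≡1 {suc n} b (suc i , r , i≡) with b zero in s
... | true  = contradiction (i≡ s) λ ()
... | false = ∃!⇒∑≡1 (b ∘ suc) (i , r , λ t → Fin.suc-injective (i≡ t))

windowᵇ : (Fin (suc n) → Fin N) → Fin (suc n) → Fin (suc n) → Bool
windowᵇ x i k = ((run x i ≡ᵇ run x k) ∧ (x k <ᶠ x i)) ∨ ((suc (run x i) ≡ᵇ run x k) ∧ (x i <ᶠ x k))

∧⁻ : ∀ {a b} → (a ∧ b) ≡ true → a ≡ true × b ≡ true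
∧⁻ {true} {true} _ = refl , refl

∨⁻ : ∀ {a b} → (a ∨ b) ≡ true → a ≡ true ⊎ b ≡ true
∨⁻ {true}  _ = inj₁ refl
∨⁻ {false} p = inj₂ p

≡ᵇ⁻ : ∀ {k l} → (k ≡ᵇ l) ≡ true → k ≡ l
≡ᵇ⁻ {k} {l} p = ℕ.≡ᵇ⇒≡ k l (Equivalence.from T-≡ p)

≡ᵇ⁺ : ∀ {k l} → k ≡ l → (k ≡ᵇ l) ≡ true
≡ᵇ⁺ {k} {l} p = Equivalence.to T-≡ (ℕ.≡⇒≡ᵇ k l p)

≡ᵇ-comm : ∀ k l → (k ≡ᵇ l) ≡ (l ≡ᵇ k)
≡ᵇ-comm zero    zero    = refl
≡ᵇ-comm zero    (suc l) = refl
≡ᵇ-comm (suc k) zero    = refl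
≡ᵇ-comm (suc k) (suc l) = ≡ᵇ-comm k l

module _ (x : Fin (suc n) → Fin N) {i k : Fin (suc n)} where

  windowᵇ⁻ : windowᵇ x i k ≡ true → Window x i k
  windowᵇ⁻ p with ∨⁻ {(run x i ≡ᵇ run x k) ∧ (x k <ᶠ x i)} p
  ... | inj₁ q = inj₁ (≡ᵇ⁻ (proj₁ (∧⁻ q)) , <ᶠ⇒< (proj₂ (∧⁻ {run x i ≡ᵇ run x k} q)))
  ... | inj₂ q = inj₂ (≡ᵇ⁻ (proj₁ (∧⁻ q)) , <ᶠ⇒< (proj₂ (∧⁻ {suc (run x i) ≡ᵇ run x k} q)))

  windowᵇ⁺ : Window x i k → windowᵇ x i k ≡ true
  windowᵇ⁺ (inj₁ (p , q)) rewrite ≡ᵇ⁺ p | <⇒<ᵇ≡true q = refl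
  windowᵇ⁺ (inj₂ (p , q)) rewrite ≡ᵇ⁺ p | <⇒<ᵇ≡true q | ≤⇒<ᵇ≡false (ℕ.<⇒≤ q) with run x i ≡ᵇ run x k
  ... | true  = refl
  ... | false = refl

∃!-map : {P Q : Fin n → Set} → (∀ i → P i → Q i) → (∀ i → Q i → P i) → ∃! _≡_ P → ∃! _≡_ Q
∃!-map f g (i , p , i≡) = i , f i p , λ {j} q → i≡ (g j q)

<ᶠ-exclusive : (i : Fin m) (j : Fin n) → ((i <ᶠ j) ∧ (j <ᶠ i)) ≡ false
<ᶠ-exclusive i j with toℕ i <ᵇ toℕ j | compare (toℕ i) (toℕ j)
... | _ | less i<j  = ≤⇒<ᵇ≡false (ℕ.<⇒≤ i<j)
... | _ | notLess _ = refl

-- Merges the two counts in a schedule number; no letter is counted twice, since it cannot be both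
-- smaller and larger than the given one.
indicator-+ : ∀ c d u s l → (s ∧ l) ≡ false →
  indicator (c ∧ u ∧ s) + indicator (d ∧ u ∧ l) ≡ indicator (u ∧ ((c ∧ s) ∨ (d ∧ l)))
indicator-+ true  true  true  true  false p = refl
indicator-+ true  true  true  false l     p = refl
indicator-+ true  true  false s     l     p = refl
indicator-+ true  false true  true  l     p = refl
indicator-+ true  false true  false l     p = refl
indicator-+ true  false false s     l     p = refl
indicator-+ false true  u     s     l     p = refl
indicator-+ false false true  s     l     p = refl
indicator-+ false false false s     l     p = refl

-- The letter 0 is smaller than its successor and so forms run 0 by itself; hence `ℕ.pred` in
-- `schedule` truncates nothing.
run-letter : (τ : Permutation′ n) (i : Fin n) → run (letter τ) (suc i) ≡ suc (ℕ.pred (run (letter τ) (suc i)))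
run-letter {suc n} τ i = refl

module _ (τ : Permutation′ n) (D : Subset n) where

  private
    x : Fin (suc n) → Fin (suc n)
    x = letter τ

  isUndecorated : Fin (suc n) → Bool
  isUndecorated k = does (undecorated? D (letter τ k))

  private
    u = isUndecorated

    x-injective : ∀ {i j} → x i ≡ x j → i ≡ j
    x-injective = permute-injective (lift₀ τ)

    smaller : (a : Fin (suc n)) → List (Fin (suc n)) → ℕ
    smaller a = count (λ k → undecorated? D k ×-dec (k Fin.<? a))

    larger : (a : Fin (suc n)) → List (Fin (suc n)) → ℕ
    larger a = count (λ k → undecorated? D k ×-dec (a Fin.<? k))

    word-tabulate : word τ ≡ tabulate x
    word-tabulate = List.map-tabulate id (letter τ)

    scheduleIn : Bool → Fin (suc n) → List (List (Fin (suc n))) → ℕ → ℕ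
    scheduleIn b a rs j =
      if b then larger a (nthRun rs j) + smaller a (nthRun rs (ℕ.pred j))
           else smaller a (nthRun rs j) + larger a (nthRun rs (suc j))

    schedule-run : ∀ i → schedule (τ , D) i ≡ scheduleIn (u (suc i)) (x (suc i)) (runs (tabulate x)) (run x (suc i))
    schedule-run i = trans
      (cong (λ w → scheduleIn (u (suc i)) (x (suc i)) (runs w) (runIndex (x (suc i)) (runs w))) word-tabulate)
      (cong (scheduleIn (u (suc i)) (x (suc i)) (runs (tabulate x))) (runIndex-run x x-injective (suc i)))

  schedule-undecorated : ∀ i → u (suc i) ≡ true →
    schedule (τ , D) i ≡ ∑ (λ p → indicator (u p ∧ windowᵇ x p (suc i)))
  schedule-undecorated i uᵢ = begin
    schedule (τ , D) i
      ≡⟨ schedule-run i ⟩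
    scheduleIn (u (suc i)) a (runs (tabulate x)) (run x (suc i))
      ≡⟨ cong₂ (λ b j → scheduleIn b a (runs (tabulate x)) j) uᵢ r-suc ⟩
    larger a (nthRun (runs (tabulate x)) (suc r)) + smaller a (nthRun (runs (tabulate x)) r)
      ≡⟨ cong₂ _+_ (count-run (λ k → undecorated? D k ×-dec (a Fin.<? k)) x (suc r))
                   (count-run (λ k → undecorated? D k ×-dec (k Fin.<? a)) x r) ⟩
    ∑ f + ∑ g
      ≡⟨ ∑-distrib-+ f g ⟨
    ∑ (λ p → f p + g p)
      ≡⟨ sum-cong-≗ (λ p → trans
           (indicator-+ (run x p ≡ᵇ suc r) (run x p ≡ᵇ r) (u p) (a <ᶠ x p) (x p <ᶠ a) (<ᶠ-exclusive a (x p)))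
           (cong (λ j → indicator (u p ∧ (((run x p ≡ᵇ j) ∧ (a <ᶠ x p)) ∨ ((suc (run x p) ≡ᵇ j) ∧ (x p <ᶠ a))))) (sym r-suc))) ⟩
    ∑ (λ p → indicator (u p ∧ windowᵇ x p (suc i))) ∎
    where
    open ≡-Reasoning
    a = x (suc i)
    r = ℕ.pred (run x (suc i))
    r-suc : run x (suc i) ≡ suc r
    r-suc = run-letter τ i
    f g : Fin (suc n) → ℕ
    f p = indicator ((run x p ≡ᵇ suc r) ∧ u p ∧ (a <ᶠ x p))
    g p = indicator ((run x p ≡ᵇ r) ∧ u p ∧ (x p <ᶠ a))

  schedule-decorated : ∀ i → u (suc i) ≡ false →
    schedule (τ , D) i ≡ ∑ (λ p → indicator (u p ∧ windowᵇ x (suc i) p))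
  schedule-decorated i uᵢ = begin
    schedule (τ , D) i
      ≡⟨ schedule-run i ⟩
    scheduleIn (u (suc i)) a (runs (tabulate x)) r
      ≡⟨ cong (λ b → scheduleIn b a (runs (tabulate x)) r) uᵢ ⟩
    smaller a (nthRun (runs (tabulate x)) r) + larger a (nthRun (runs (tabulate x)) (suc r))
      ≡⟨ cong₂ _+_ (count-run (λ k → undecorated? D k ×-dec (k Fin.<? a)) x r)
                   (count-run (λ k → undecorated? D k ×-dec (a Fin.<? k)) x (suc r)) ⟩
    ∑ f + ∑ g
      ≡⟨ ∑-distrib-+ f g ⟨
    ∑ (λ p → f p + g p)
      ≡⟨ sum-cong-≗ (λ p → trans
           (indicator-+ (run x p ≡ᵇ r) (run x p ≡ᵇ suc r) (u p) (x p <ᶠ a) (a <ᶠ x p) (<ᶠ-exclusive (x p) a))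
           (cong₂ (λ c d → indicator (u p ∧ ((c ∧ (x p <ᶠ a)) ∨ (d ∧ (a <ᶠ x p)))))
             (≡ᵇ-comm (run x p) r) (≡ᵇ-comm (run x p) (suc r)))) ⟩
    ∑ (λ p → indicator (u p ∧ windowᵇ x (suc i) p)) ∎
    where
    open ≡-Reasoning
    a = x (suc i)
    r = run x (suc i)
    f g : Fin (suc n) → ℕ
    f p = indicator ((run x p ≡ᵇ r) ∧ u p ∧ (x p <ᶠ a))
    g p = indicator ((run x p ≡ᵇ suc r) ∧ u p ∧ (a <ᶠ x p))

  private
    undec-window⁻ : ∀ p i k → (u p ∧ windowᵇ x i k) ≡ true → Undec u p × Window x i k
    undec-window⁻ p i k q = proj₁ (∧⁻ q) , windowᵇ⁻ x (proj₂ (∧⁻ {u p} q))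

    undec-window⁺ : ∀ p i k → Undec u p × Window x i k → (u p ∧ windowᵇ x i k) ≡ true
    undec-window⁺ p i k (q , w) = cong₂ _∧_ q (windowᵇ⁺ x w)

  unitSchedule⇒unit : UnitSchedule (τ , D) → Unit x u
  unitSchedule⇒unit unit i =
    (λ uᵢ → ∃!-map (λ p → undec-window⁻ p p (suc i)) (λ p → undec-window⁺ p p (suc i)) (∑≡1⇒∃! (λ p → u p ∧ windowᵇ x p (suc i)) (trans (sym (schedule-undecorated i uᵢ)) (unit i)))) ,
    (λ uᵢ → ∃!-map (λ p → undec-window⁻ p (suc i) p) (λ p → undec-window⁺ p (suc i) p) (∑≡1⇒∃! (λ p → u p ∧ windowᵇ x (suc i) p) (trans (sym (schedule-decorated i uᵢ)) (unit i))))

  unit⇒unitSchedule : Unit x u → UnitSchedule (τ , D)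
  unit⇒unitSchedule unit i = byCase (u (suc i)) refl
    where
    byCase : ∀ b → u (suc i) ≡ b → schedule (τ , D) i ≡ 1
    byCase true  uᵢ = trans (schedule-undecorated i uᵢ)
      (∃!⇒∑≡1 (λ p → u p ∧ windowᵇ x p (suc i)) (∃!-map (λ p → undec-window⁺ p p (suc i)) (λ p → undec-window⁻ p p (suc i)) (proj₁ (unit i) uᵢ)))
    byCase false uᵢ = trans (schedule-decorated i uᵢ)
      (∃!⇒∑≡1 (λ p → u p ∧ windowᵇ x (suc i) p) (∃!-map (λ p → undec-window⁺ p (suc i) p) (λ p → undec-window⁻ p (suc i) p) (proj₂ (unit i) uᵢ)))

-- The unique decoration with unit schedule numbers

does-∈? : (D : Subset n) (k : Fin n) → does (k Subset.∈? D) ≡ Vec.lookup D k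
does-∈? (inside  Vec.∷ D) zero    = refl
does-∈? (outside Vec.∷ D) zero    = refl
does-∈? (_       Vec.∷ D) (suc k) = does-∈? D k

∣∣-∑ : (D : Subset n) → ∣ D ∣ ≡ ∑ (indicator ∘ Vec.lookup D)
∣∣-∑ Vec.[]              = refl
∣∣-∑ (inside  Vec.∷ D) = cong suc (∣∣-∑ D)
∣∣-∑ (outside Vec.∷ D) = ∣∣-∑ D

module _ (τ : Permutation′ n) where

  private
    c = cyclicCode zero τ

  letter-rule : (u : Fin (suc n) → Bool) → (∀ i → u i ≡ undecoratedPositions c i) → Rule (letter τ) u
  letter-rule u u≡ i = ∃!-map
    (λ k (p , w) → trans (u≡ k) p , window-invariant (around zero τ) (letter τ) around-letter w)
    (λ k (p , w) → trans (sym (u≡ k)) p , window-invariant (letter τ) (around zero τ) (λ i j → sym (around-letter i j)) w)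
    (code-rule zero τ i)
    where
    letter≡ : ∀ i → around zero τ i ≡ letter τ i
    letter≡ zero    = refl
    letter≡ (suc i) = refl
    around-letter : ∀ i j → (around zero τ i <ᶠ around zero τ j) ≡ (letter τ i <ᶠ letter τ j)
    around-letter i j = cong₂ _<ᶠ_ (letter≡ i) (letter≡ j)

  -- The code decorates positions and the subset records letters, hence the inverse of `τ`.
  decoration : Subset n
  decoration = Vec.tabulate (λ v → decorations c (τ ⟨$⟩ˡ v))

  decoration-unit : UnitSchedule (τ , decoration)
  decoration-unit = unit⇒unitSchedule τ decoration (rule⇒unit (letter τ) u refl (letter-rule u u≡))
    where
    u = isUndecorated τ decoration
    u≡ : ∀ i → u i ≡ undecoratedPositions c i
    u≡ zero    = refl
    u≡ (suc i) = cong not (begin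
      does ((τ ⟨$⟩ʳ i) Subset.∈? decoration)  ≡⟨ does-∈? decoration (τ ⟨$⟩ʳ i) ⟩
      Vec.lookup decoration (τ ⟨$⟩ʳ i)        ≡⟨ Vec.lookup∘tabulate _ (τ ⟨$⟩ʳ i) ⟩
      decorations c (τ ⟨$⟩ˡ (τ ⟨$⟩ʳ i))       ≡⟨ cong (decorations c) (inverseˡ τ) ⟩
      decorations c i                         ∎)
      where open ≡-Reasoning

  module _ (D : Subset n) (unit : UnitSchedule (τ , D)) where

    -- The given decoration and that of the code obey `Rule` for the same word, so `rule-unique`
    -- identifies them.
    lookup-decorations : ∀ i → Vec.lookup D (τ ⟨$⟩ʳ i) ≡ decorations c i
    lookup-decorations i = trans (sym (does-∈? D (τ ⟨$⟩ʳ i))) (not-injective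
      (rule-unique (letter τ) (permute-injective (lift₀ τ)) (isUndecorated τ D) (undecoratedPositions c)
        (unit⇒rule (letter τ) (isUndecorated τ D) refl (unitSchedule⇒unit τ D unit))
        (letter-rule (undecoratedPositions c) (λ _ → refl)) i))

    dec-decorations : ∣ D ∣ ≡ ∑ (indicator ∘ decorations c)
    dec-decorations = trans (∣∣-∑ D) (trans (sum-permute (indicator ∘ Vec.lookup D) τ)
      (sum-cong-≗ (λ i → cong indicator (lookup-decorations i))))

lookup-injective : (D E : Subset n) → (∀ i → Vec.lookup D i ≡ Vec.lookup E i) → D ≡ E
lookup-injective D E p = trans (sym (Vec.tabulate∘lookup D)) (trans (Vec.tabulate-cong p) (Vec.tabulate∘lookup E))

decoration-unique : (τ ρ : Permutation′ n) → τ ≈ ρ → (D E : Subset n) →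
                    UnitSchedule (τ , D) → UnitSchedule (ρ , E) → D ≡ E
decoration-unique τ ρ τ≈ρ D E unitD unitE = lookup-injective D E λ v → begin
  Vec.lookup D v                                ≡⟨ cong (Vec.lookup D) (inverseʳ τ) ⟨
  Vec.lookup D (τ ⟨$⟩ʳ (τ ⟨$⟩ˡ v))              ≡⟨ lookup-decorations τ D unitD (τ ⟨$⟩ˡ v) ⟩
  decorations (cyclicCode zero τ) (τ ⟨$⟩ˡ v)    ≡⟨ cong (λ c → decorations c (τ ⟨$⟩ˡ v)) (cyclicCode-cong zero τ ρ τ≈ρ) ⟩
  decorations (cyclicCode zero ρ) (τ ⟨$⟩ˡ v)    ≡⟨ lookup-decorations ρ E unitE (τ ⟨$⟩ˡ v) ⟨
  Vec.lookup E (ρ ⟨$⟩ʳ (τ ⟨$⟩ˡ v))              ≡⟨ cong (Vec.lookup E) (trans (sym (τ≈ρ _)) (inverseʳ τ)) ⟩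
  Vec.lookup E v                                ∎
  where open ≡-Reasoning

-- The bijection

theorem5p1 : (n : ℕ) → 1 ≤ n →
    Σ[ φ ∈ Bijection (unitScheduleSetoid n) (permutationSetoid n) ]
    ((τ : DecoratedPermutation n) (u : UnitSchedule τ) →
    (revmaj τ ≡ inv₃ (Bijection.to φ (τ , u))) ×
    (dec τ ≡ monot (Bijection.to φ (τ , u))))
theorem5p1 n _ = φ , λ (τ , D) u →
    trans (reverseMaj-weight τ) (trans (cong weight (sym (code τ))) (sym (inv₃-weight (image τ))))
  , trans (dec-decorations τ D u) (trans (cong (λ c → ∑ (indicator ∘ decorations c)) (sym (code τ))) (sym (monot-decorations (image τ))))
  where
  image : Permutation′ n → Permutation′ n
  image τ = fromZigzagCode (cyclicCode zero τ)

  code : ∀ τ → zigzagCode (image τ) ≡ cyclicCode zero τ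
  code τ = zigzagCode-fromZigzagCode (cyclicCode zero τ)

  image-cong : ∀ τ ρ → τ ≈ ρ → image τ ≈ image ρ
  image-cong τ ρ τ≈ρ i = cong (λ c → fromZigzagCode c ⟨$⟩ʳ i) (cyclicCode-cong zero τ ρ τ≈ρ)

  image-injective : ∀ τ ρ → image τ ≈ image ρ → τ ≈ ρ
  image-injective τ ρ p = cyclicCode-injective zero τ ρ
    (trans (sym (code τ)) (trans (zigzagCode-cong (image τ) (image ρ) p) (code ρ)))

  image-fromCyclicCode : ∀ σ → image (fromCyclicCode zero (zigzagCode σ)) ≈ σ
  image-fromCyclicCode σ = zigzagCode-injective _ σ (trans (code _) (cyclicCode-fromCyclicCode zero (zigzagCode σ)))

  φ : Bijection (unitScheduleSetoid n) (permutationSetoid n)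
  φ = record
    { to        = λ ((τ , _) , _) → image τ
    ; cong      = λ { {(τ , _) , _} {(ρ , _) , _} (τ≈ρ , _) → image-cong τ ρ τ≈ρ }
    ; bijective =
        (λ { {(τ , D) , u} {(ρ , E) , v} p →
             -- Equality in the domain includes the decorations; the permutation together with the
             -- unit schedule numbers determines them.
             image-injective τ ρ p , decoration-unique τ ρ (image-injective τ ρ p) D E u v })
      , λ σ → let τ = fromCyclicCode zero (zigzagCode σ) in
          ((τ , decoration τ) , decoration-unit τ) ,
          λ { {(ρ , _) , _} (ρ≈τ , _) i → trans (image-cong ρ τ ρ≈τ i) (image-fromCyclicCode σ i) }
    }
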